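{- Let $G$ be a finite group and $H\leqslant G$. Let $H_2$ be a Sylow $2$-subgroup of $H$, let $N_G(H_2)_2$ be a Sylow $2$-subgroup of the normalizer $N_G(H_2)$, and assume that $P$ is a Sylow $2$-subgroup of $G$ such that $N_G(H_2)_2\leqslant P$. Then the following statements are equivalent: (1) $H_2$ is a perfect code of $P$; (2) $\Omega_1(N_G(H_2)_2/H_2)=\Omega_1(N_G(H_2)_2)H_2$; (3) $\Omega_1(N_G(H_2)/H_2)=\Omega_1(N_G(H_2))H_2$; (4) $H$ is a perfect code of $G$.
   Context: All groups are finite; all graphs are finite, undirected and simple. For a group $G$ and an inverse-closed subset $S\subseteq G\setminus\{1\}$, the Cayley graph $\mathrm{Cay}(G,S)$ has vertex set $G$, with $x,y\in G$ adjacent if and only if $yx^{ -1}\in S$. A subset $C$ of the vertex set of a graph $\Gamma$ is a perfect code in $\Gamma$ if $C$ is an independent set and every vertex of $\Gamma$ is at distance at most $1$ from exactly one vertex of $C$. A subgroup $H$ of a group $G$ is called a perfect code of $G$ if there exists a Cayley graph $\mathrm{Cay}(G,S)$ of $G$ in which $H$ is a perfect code. For any finite group $X$, $\Omega_1(X)=\{g\in X: g^2=1\}$ (a set, including the identity, not necessarily a subgroup). For $N\trianglelefteq X$, $\Omega_1(X)N$ denotes $\bigcup_{g\in\Omega_1(X)}Ng$, and the equality $\Omega_1(X/N)=\Omega_1(X)N$ is understood as an equality of collections of cosets of $N$ in $X$: a coset $Nx$ satisfies $(Nx)^2=N$ if and only if $Nx=Ng$ for some $g\in X$ with $g^2=1$.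 Note that $H_2$, being a normal $2$-subgroup of $N_G(H_2)$, is contained in $N_G(H_2)_2$. -}

module Defs where

open import Algebra.Bundles using (Group)
open import Data.Fin.Base using (Fin)
open import Data.Nat.Base using (ℕ; zero; suc; _≤_; _*_; _^_)
open import Data.Nat.Divisibility using (_∣_)
open import Data.Product.Base using (Σ; ∃; _×_; _,_; proj₁; proj₂)
open import Data.Product using (∃!)
open import Function.Base using (_∘_; _on_)
open import Function.Bundles using (Inverse; _⇔_; mk⇔; Equivalence)
open import Level using (Level; _⊔_) renaming (suc to lsuc)
open import Relation.Binary.Bundles using (Setoid)
open import Relation.Binary.Core using (Rel)
open import Relation.Binary.Definitions using (Symmetric; _Respects_; _Respects₂_)
open import Relation.Binary.PropositionalEquality using () renaming (setoid to ≡-setoid)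
open import Relation.Nullary using (¬_)
open import Relation.Unary using (Pred; _∈_; _∉_) renaming (_⊆_ to _⊆ₚ_)
import Algebra.Properties.Group as GroupProperties
import Relation.Binary.Reasoning.Setoid as SetoidReasoning

record Graph (v ℓ e : Level) : Set (lsuc (v ⊔ ℓ ⊔ e)) where
  field
    vertices : Setoid v ℓ
  open Setoid vertices public using (_≈_) renaming (Carrier to Vertex)
  field
    Adj     : Rel Vertex e
    Adj-≈   : Adj Respects₂ _≈_
    sym     : Symmetric Adj
    irrefl  : ∀ x → ¬ Adj x x

module _ {v ℓ e : Level} (Γ : Graph v ℓ e) where
  open Graph Γ

  data Walk : ℕ → Vertex → Vertex → Set (v ⊔ ℓ ⊔ e) where
    nil  : ∀ {x y} → x ≈ y → Walk zero x y
    step : ∀ {n x y z} → Adj x y → Walk n y z → Walk (suc n) x z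

  DistanceAtMost : ℕ → Vertex → Vertex → Set (v ⊔ ℓ ⊔ e)
  DistanceAtMost k x y = ∃ λ n → n ≤ k × Walk n x y

  record IsPerfectCode {p : Level} (C : Pred Vertex p) : Set (v ⊔ ℓ ⊔ e ⊔ p) where
    field
      independent : ∀ {x y} → x ∈ C → y ∈ C → ¬ Adj x y
      perfect     : ∀ x → ∃! _≈_ λ y → y ∈ C × DistanceAtMost 1 x y

HasOrder : ∀ {c ℓ} → Group c ℓ → ℕ → Set (c ⊔ ℓ)
HasOrder G n = Inverse (≡-setoid (Fin n)) (Group.setoid G)

Finite : ∀ {c ℓ} → Group c ℓ → Set (c ⊔ ℓ)
Finite G = ∃ λ n → HasOrder G n

-- Subsets of a group are predicates respecting its setoid equality.  They
-- live at level c ⊔ ℓ, so that normalizers and subgroups of subgroups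
-- stay at the same level.  Decidability is not required: it follows from
-- finiteness of the subgroup and of the ambient group.

record Subgroup {c ℓ : Level} (G : Group c ℓ) : Set (lsuc (c ⊔ ℓ)) where
  open Group G
  field
    member : Pred Carrier (c ⊔ ℓ)
    resp   : member Respects _≈_
    ε∈     : ε ∈ member
    ∙∈     : ∀ {x y} → x ∈ member → y ∈ member → x ∙ y ∈ member
    ⁻¹∈    : ∀ {x} → x ∈ member → x ⁻¹ ∈ member

open Subgroup public using (member)

infix 4 _⊆_

_⊆_ : ∀ {c ℓ} {G : Group c ℓ} → Subgroup G → Subgroup G → Set (c ⊔ ℓ)
K ⊆ L = member K ⊆ₚ member L

toGroup : ∀ {c ℓ} {G : Group c ℓ} → Subgroup G → Group (c ⊔ ℓ) ℓ
toGroup {G = G} H = record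
  { Carrier = Σ Carrier (member H)
  ; _≈_     = _≈_ on proj₁
  ; _∙_     = λ (x , x∈H) (y , y∈H) → x ∙ y , H.∙∈ x∈H y∈H
  ; ε       = ε , H.ε∈
  ; _⁻¹     = λ (x , x∈H) → x ⁻¹ , H.⁻¹∈ x∈H
  ; isGroup = record
    { isMonoid = record
      { isSemigroup = record
        { isMagma = record
          { isEquivalence = record { refl = refl ; sym = sym ; trans = trans }
          ; ∙-cong        = ∙-cong
          }
        ; assoc = λ x y z → assoc (proj₁ x) (proj₁ y) (proj₁ z)
        }
      ; identity = identityˡ ∘ proj₁ , identityʳ ∘ proj₁
      }
    ; inverse = inverseˡ ∘ proj₁ , inverseʳ ∘ proj₁
    ; ⁻¹-cong = ⁻¹-cong
    }
  }
  where
  open Group G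
  module H = Subgroup H

-- K ∩ L as a subgroup of the group L.  When K ⊆ L this is K itself,
-- viewed as a subgroup of L; totality in K and L lets H₂ be regarded as a
-- subgroup of a Sylow subgroup of N(H₂) without first proving containment.

infixl 6 _↾_

_↾_ : ∀ {c ℓ} {G : Group c ℓ} → Subgroup G → (L : Subgroup G) → Subgroup (toGroup L)
K ↾ L = record
  { member = member K ∘ proj₁
  ; resp   = K.resp
  ; ε∈     = K.ε∈
  ; ∙∈     = K.∙∈
  ; ⁻¹∈    = K.⁻¹∈
  }
  where module K = Subgroup K

record IsSylow {c ℓ : Level} (p : ℕ) (G : Group c ℓ) (K : Subgroup G) : Set (c ⊔ ℓ) where
  field
    exponent cofactor : ℕ
    order-subgroup    : HasOrder (toGroup K) (p ^ exponent)
    order-group       : HasOrder G (p ^ exponent * cofactor)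
    coprime           : ¬ p ∣ cofactor

IsSylowOf : ∀ {c ℓ} {G : Group c ℓ} → ℕ → Subgroup G → Subgroup G → Set (c ⊔ ℓ)
IsSylowOf p L K = K ⊆ L × IsSylow p (toGroup L) (K ↾ L)

module _ {c ℓ : Level} {G : Group c ℓ} where
  open Group G
  open GroupProperties G
  open SetoidReasoning setoid

  private
    conj-ε : ∀ x → ε ∙ x ∙ ε ⁻¹ ≈ x
    conj-ε x = begin
      ε ∙ x ∙ ε ⁻¹ ≈⟨ ∙-cong (identityˡ x) ε⁻¹≈ε ⟩
      x ∙ ε        ≈⟨ identityʳ x ⟩
      x            ∎

    conj-∙ : ∀ g h x → g ∙ (h ∙ x ∙ h ⁻¹) ∙ g ⁻¹ ≈ (g ∙ h) ∙ x ∙ (g ∙ h) ⁻¹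
    conj-∙ g h x = begin
      g ∙ (h ∙ x ∙ h ⁻¹) ∙ g ⁻¹   ≈⟨ ∙-congʳ (assoc g (h ∙ x) (h ⁻¹)) ⟨
      g ∙ (h ∙ x) ∙ h ⁻¹ ∙ g ⁻¹   ≈⟨ ∙-congʳ (∙-congʳ (assoc g h x)) ⟨
      g ∙ h ∙ x ∙ h ⁻¹ ∙ g ⁻¹     ≈⟨ assoc (g ∙ h ∙ x) (h ⁻¹) (g ⁻¹) ⟩
      g ∙ h ∙ x ∙ (h ⁻¹ ∙ g ⁻¹)   ≈⟨ ∙-congˡ (⁻¹-anti-homo-∙ g h) ⟨
      g ∙ h ∙ x ∙ (g ∙ h) ⁻¹      ∎

    conj-cong : ∀ {g h} x → g ≈ h → g ∙ x ∙ g ⁻¹ ≈ h ∙ x ∙ h ⁻¹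
    conj-cong x g≈h = ∙-cong (∙-congʳ g≈h) (⁻¹-cong g≈h)

    conj-inv : ∀ g x → g ∙ (g ⁻¹ ∙ x ∙ g ⁻¹ ⁻¹) ∙ g ⁻¹ ≈ x
    conj-inv g x = begin
      g ∙ (g ⁻¹ ∙ x ∙ g ⁻¹ ⁻¹) ∙ g ⁻¹   ≈⟨ conj-∙ g (g ⁻¹) x ⟩
      g ∙ g ⁻¹ ∙ x ∙ (g ∙ g ⁻¹) ⁻¹      ≈⟨ conj-cong x (inverseʳ g) ⟩
      ε ∙ x ∙ ε ⁻¹                      ≈⟨ conj-ε x ⟩
      x                                 ∎

  normalizer : Subgroup G → Subgroup G
  normalizer K = record
    { member = λ g → ∀ x → x ∈ member K ⇔ g ∙ x ∙ g ⁻¹ ∈ member K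
    ; resp   = λ g≈h n x → mk⇔
        (K.resp (conj-cong x g≈h) ∘ to (n x))
        (from (n x) ∘ K.resp (conj-cong x (sym g≈h)))
    ; ε∈     = λ x → mk⇔ (K.resp (sym (conj-ε x))) (K.resp (conj-ε x))
    ; ∙∈     = λ {g} {h} m n x → mk⇔
        (K.resp (conj-∙ g h x) ∘ to (m _) ∘ to (n x))
        (from (n x) ∘ from (m _) ∘ K.resp (sym (conj-∙ g h x)))
    ; ⁻¹∈    = λ {g} n x → mk⇔
        (from (n _) ∘ K.resp (sym (conj-inv g x)))
        (K.resp (conj-inv g x) ∘ to (n _))
    }
    where
    module K = Subgroup K
    open Equivalence using (to; from)

IsNormal : ∀ {c ℓ} (X : Group c ℓ) → Subgroup X → Set (c ⊔ ℓ)
IsNormal X N = ∀ g {x} → x ∈ member N → g ∙ x ∙ g ⁻¹ ∈ member N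
  where open Group X

normal-in-normalizer : ∀ {c ℓ} {G : Group c ℓ} (K L : Subgroup G) →
                       L ⊆ normalizer K → IsNormal (toGroup L) (K ↾ L)
normal-in-normalizer K L L⊆N (g , g∈L) {x , _} = Equivalence.to (L⊆N g∈L x)

-- The element x of the quotient represents the coset Nx.

module _ {c ℓ : Level} (X : Group c ℓ) (N : Subgroup X) (normal : IsNormal X N) where
  open Group X
  open GroupProperties X
  open SetoidReasoning setoid
  private
    module N = Subgroup N

    _∼_ : Rel Carrier (c ⊔ ℓ)
    x ∼ y = x ∙ y ⁻¹ ∈ member N

    ≈⇒∼ : ∀ {x y} → x ≈ y → x ∼ y
    ≈⇒∼ {x} {y} x≈y =
      N.resp (sym (trans (∙-congʳ x≈y) (inverseʳ y))) N.ε∈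

    ∼-sym : ∀ {x y} → x ∼ y → y ∼ x
    ∼-sym {x} {y} x∼y = N.resp
      (trans (⁻¹-anti-homo-∙ x (y ⁻¹)) (∙-congʳ (⁻¹-involutive y)))
      (N.⁻¹∈ x∼y)

    ∼-trans : ∀ {x y z} → x ∼ y → y ∼ z → x ∼ z
    ∼-trans {x} {y} {z} x∼y y∼z = N.resp eq (N.∙∈ x∼y y∼z)
      where
      eq : x ∙ y ⁻¹ ∙ (y ∙ z ⁻¹) ≈ x ∙ z ⁻¹
      eq = begin
        x ∙ y ⁻¹ ∙ (y ∙ z ⁻¹)   ≈⟨ assoc x (y ⁻¹) (y ∙ z ⁻¹) ⟩
        x ∙ (y ⁻¹ ∙ (y ∙ z ⁻¹)) ≈⟨ ∙-congˡ (\\-leftDividesʳ y (z ⁻¹)) ⟩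
        x ∙ z ⁻¹                ∎

    ∼-∙-cong : ∀ {x y u v} → x ∼ y → u ∼ v → (x ∙ u) ∼ (y ∙ v)
    ∼-∙-cong {x} {y} {u} {v} x∼y u∼v = N.resp eq (N.∙∈ (normal x u∼v) x∼y)
      where
      eq : x ∙ (u ∙ v ⁻¹) ∙ x ⁻¹ ∙ (x ∙ y ⁻¹) ≈ x ∙ u ∙ (y ∙ v) ⁻¹
      eq = begin
        x ∙ (u ∙ v ⁻¹) ∙ x ⁻¹ ∙ (x ∙ y ⁻¹)   ≈⟨ assoc _ (x ⁻¹) (x ∙ y ⁻¹) ⟩
        x ∙ (u ∙ v ⁻¹) ∙ (x ⁻¹ ∙ (x ∙ y ⁻¹)) ≈⟨ ∙-congˡ (\\-leftDividesʳ x (y ⁻¹)) ⟩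
        x ∙ (u ∙ v ⁻¹) ∙ y ⁻¹                ≈⟨ ∙-congʳ (assoc x u (v ⁻¹)) ⟨
        x ∙ u ∙ v ⁻¹ ∙ y ⁻¹                  ≈⟨ assoc (x ∙ u) (v ⁻¹) (y ⁻¹) ⟩
        x ∙ u ∙ (v ⁻¹ ∙ y ⁻¹)                ≈⟨ ∙-congˡ (⁻¹-anti-homo-∙ y v) ⟨
        x ∙ u ∙ (y ∙ v) ⁻¹                   ∎

    ∼-⁻¹-cong : ∀ {x y} → x ∼ y → (x ⁻¹) ∼ (y ⁻¹)
    ∼-⁻¹-cong {x} {y} x∼y = N.resp eq (normal (x ⁻¹) (∼-sym x∼y))
      where
      eq : x ⁻¹ ∙ (y ∙ x ⁻¹) ∙ x ⁻¹ ⁻¹ ≈ x ⁻¹ ∙ y ⁻¹ ⁻¹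
      eq = begin
        x ⁻¹ ∙ (y ∙ x ⁻¹) ∙ x ⁻¹ ⁻¹   ≈⟨ assoc (x ⁻¹) (y ∙ x ⁻¹) (x ⁻¹ ⁻¹) ⟩
        x ⁻¹ ∙ (y ∙ x ⁻¹ ∙ x ⁻¹ ⁻¹)   ≈⟨ ∙-congˡ (//-rightDividesʳ (x ⁻¹) y) ⟩
        x ⁻¹ ∙ y                      ≈⟨ ∙-congˡ (⁻¹-involutive y) ⟨
        x ⁻¹ ∙ y ⁻¹ ⁻¹                ∎

  quotient : Group c (c ⊔ ℓ)
  quotient = record
    { Carrier = Carrier
    ; _≈_     = λ x y → x ∙ y ⁻¹ ∈ member N
    ; _∙_     = _∙_
    ; ε       = ε
    ; _⁻¹     = _⁻¹
    ; isGroup = record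
      { isMonoid = record
        { isSemigroup = record
          { isMagma = record
            { isEquivalence = record
              { refl = ≈⇒∼ refl ; sym = ∼-sym ; trans = ∼-trans }
            ; ∙-cong = ∼-∙-cong
            }
          ; assoc = λ x y z → ≈⇒∼ (assoc x y z)
          }
        ; identity = ≈⇒∼ ∘ identityˡ , ≈⇒∼ ∘ identityʳ
        }
      ; inverse = ≈⇒∼ ∘ inverseˡ , ≈⇒∼ ∘ inverseʳ
      ; ⁻¹-cong = ∼-⁻¹-cong
      }
    }

Ω₁ : ∀ {c ℓ} (X : Group c ℓ) → Pred (Group.Carrier X) ℓ
Ω₁ X g = g ∙ g ≈ ε
  where open Group X

-- Ω₁(X)N as a collection of cosets: those of the form Ng with g ∈ Ω₁(X).

Ω₁-cosets : ∀ {c ℓ} (X : Group c ℓ) (N : Subgroup X) → IsNormal X N →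
            Pred (Group.Carrier X) (c ⊔ ℓ)
Ω₁-cosets X N normal x = ∃ λ g → g ∈ Ω₁ X × x ≈ g
  where open Group (quotient X N normal)

record ConnectionSet {c ℓ : Level} (G : Group c ℓ) : Set (lsuc (c ⊔ ℓ)) where
  open Group G
  field
    member : Pred Carrier (c ⊔ ℓ)
    resp   : member Respects _≈_
    ε∉     : ε ∉ member
    ⁻¹∈    : ∀ {x} → x ∈ member → x ⁻¹ ∈ member

Cay : ∀ {c ℓ} (G : Group c ℓ) → ConnectionSet G → Graph c ℓ (c ⊔ ℓ)
Cay G S = record
  { vertices = setoid
  ; Adj      = λ x y → y ∙ x ⁻¹ ∈ S.member
  ; Adj-≈    = (λ y≈z → S.resp (∙-congʳ y≈z))
             , (λ x≈z → S.resp (∙-congˡ (⁻¹-cong x≈z)))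
  ; sym      = λ {x} {y} yx⁻¹∈S → S.resp
      (trans (⁻¹-anti-homo-∙ y (x ⁻¹)) (∙-congʳ (⁻¹-involutive x)))
      (S.⁻¹∈ yx⁻¹∈S)
  ; irrefl   = λ x xx⁻¹∈S → S.ε∉ (S.resp (inverseʳ x) xx⁻¹∈S)
  }
  where
  open Group G
  open GroupProperties G
  module S = ConnectionSet S

IsPerfectCodeOf : ∀ {c ℓ} (G : Group c ℓ) → Subgroup G → Set (lsuc (c ⊔ ℓ))
IsPerfectCodeOf G H = ∃ λ (S : ConnectionSet G) → IsPerfectCode (Cay G S) (member H)

{-# OPTIONS --safe #-}
module Submission where

-- Write Q for H₂.  H is a perfect code of G exactly when G has an inverse-closed
-- right transversal T of H.
--
-- (3) ⇒ (4): Build T greedily, adding t and t⁻¹ from uncovered cosets.  By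
-- counting, this can only get stuck at an uncovered coset Hx whose double coset
-- D = HxH is self-inverse, has no other uncovered coset and contains no
-- involution.  Pairing the other cosets gives |D| ≡ |H| modulo 2|H|.  On the
-- other hand, decompose D into double cosets QyQ: their index over Q is even
-- unless y normalizes Q, and inversion acts on the cosets Qy with y ∈ N(Q).  So
-- 2|Q| divides |D|, and hence |H|, unless y² ∈ Q for some y ∈ D ∩ N(Q), and then
-- (3) provides an involution in Qy ⊆ D.
--
-- (4) ⇒ (3): Let x ∈ N(Q), x² ∈ Q, and let τ(y) ∈ T represent Hy.  Then
-- h ↦ x⁻¹ h τ(xh)⁻¹ induces an involution on the oddly many right cosets of Q in
-- H.  If it fixes Qh, then τ(xh) is an involution with a conjugate in Qx.
--
-- (1) is related in the same way to the lifting property in P, with Q in place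
-- of H.  As Q ⊆ N₂, that property lies between (3) and (2); and (2) implies (3)
-- because every x ∈ N(Q) with x² ∈ Q is conjugate in N(Q) to an element of N₂.

open import Defs
open import Algebra.Bundles using (Group)
open import Data.Bool.Base using (Bool; true; false; not; if_then_else_)
open import Data.Empty.Polymorphic using () renaming (⊥ to ⊥*)
open import Data.Fin.Base using (Fin; zero; suc)
open import Data.List.Base using (List; []; _∷_)
open import Data.Nat.Base using (ℕ; zero; suc; _+_; _*_; _^_; _≤_; _<_; z≤n; s≤s; NonZero; >-nonZero)
open import Data.Nat.Coprimality using (Coprime; coprime-divisor)
open import Data.Nat.Divisibility hiding (quotient)
open import Data.Nat.Primality using (irreducible[2])
open import Data.Nat.Properties as ℕ using (+-*-semiring)
open import Data.Nat.Tactic.RingSolver using (solve-∀)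
open import Data.Product.Base using (∃; _×_; _,_; proj₁; proj₂)
open import Data.Sum.Base as Sum using (_⊎_; inj₁; inj₂)
open import Data.Unit.Base using (⊤; tt)
open import Data.Vec.Base using (Vec; lookup)
open import Function.Base using (_∘_; id)
open import Function.Bundles using (_⇔_; Inverse; Equivalence; mk⇔)
open import Level using (Level; _⊔_) renaming (suc to lsuc)
open import Relation.Binary.Bundles using (Setoid)
open import Relation.Binary.Core using (Rel; REL)
open import Relation.Binary.Definitions using (_Respects_)
open import Relation.Binary.PropositionalEquality as ≡ using (_≡_)
open import Relation.Nullary using (¬_; Dec; yes; no; does; contradiction)
open import Relation.Nullary.Decidable as Dec using (_×-dec_; _⊎-dec_; _→-dec_; ¬?; decidable-stable)
open import Relation.Unary using (Pred; Decidable; _∩_; ∁; _≐_)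
open import Relation.Unary.Properties using (_∩?_; ∁?)
import Algebra.Properties.Group as GroupProperties
import Algebra.Properties.Semiring.Sum
import Data.Fin.Properties as Fin
import Relation.Binary.Reasoning.Setoid as SetoidReasoning
import Relation.Binary.Reflection as Reflection

module Σ = Algebra.Properties.Semiring.Sum +-*-semiring
open Σ using (sum)

private variable
  p q r : Level

-- Free reduction of group words

module FreeGroupSolver {c ℓ} (G : Group c ℓ) where
  open Group G
  open GroupProperties G
  open SetoidReasoning setoid

  infixl 7 _⊕_
  infix  8 ⊖_

  data Expr (n : ℕ) : Set where
    var : Fin n → Expr n
    e   : Expr n
    _⊕_ : Expr n → Expr n → Expr n
    ⊖_  : Expr n → Expr n

  Env : ℕ → Set c
  Env = Vec Carrier

  ⟦_⟧ : ∀ {n} → Expr n → Env n → Carrier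
  ⟦ var i ⟧ ρ = lookup ρ i
  ⟦ e     ⟧ ρ = ε
  ⟦ a ⊕ b ⟧ ρ = ⟦ a ⟧ ρ ∙ ⟦ b ⟧ ρ
  ⟦ ⊖ a   ⟧ ρ = ⟦ a ⟧ ρ ⁻¹

  -- The letter (i , true) stands for the variable i, (i , false) for its inverse.
  Reduced : ℕ → Set
  Reduced n = List (Fin n × Bool)

  signed : Bool → Carrier → Carrier
  signed true  x = x
  signed false x = x ⁻¹

  ⟦_⟧ᵣ : ∀ {n} → Reduced n → Env n → Carrier
  ⟦ []           ⟧ᵣ ρ = ε
  ⟦ (i , s) ∷ w ⟧ᵣ ρ = signed s (lookup ρ i) ∙ ⟦ w ⟧ᵣ ρ

  push : ∀ {n} → Fin n × Bool → Reduced n → Reduced n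
  push l [] = l ∷ []
  push (i , s) ((j , t) ∷ w) with i Fin.≟ j | s | t
  ... | yes _ | true  | false = w
  ... | yes _ | false | true  = w
  ... | _     | _     | _     = (i , s) ∷ (j , t) ∷ w

  -- The Boolean says whether the expression is to be inverted, so that inverses sink to the
  -- letters; `w` accumulates what follows on the right.
  prepend : ∀ {n} → Expr n → Bool → Reduced n → Reduced n
  prepend (var i) s w     = push (i , s) w
  prepend e       s w     = w
  prepend (a ⊕ b) true  w = prepend a true (prepend b true w)
  prepend (a ⊕ b) false w = prepend b false (prepend a false w)
  prepend (⊖ a)   s w     = prepend a (not s) w

  push-correct : ∀ {n} i s w (ρ : Env n) →
                 ⟦ push (i , s) w ⟧ᵣ ρ ≈ signed s (lookup ρ i) ∙ ⟦ w ⟧ᵣ ρ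
  push-correct i s [] ρ = refl
  push-correct i s ((j , t) ∷ w) ρ with i Fin.≟ j | s | t
  ... | yes ≡.refl | true  | false = sym (\\-leftDividesˡ _ _)
  ... | yes ≡.refl | false | true  = sym (\\-leftDividesʳ _ _)
  ... | yes _      | true  | true  = refl
  ... | yes _      | false | false = refl
  ... | no _       | _     | _     = refl

  prepend-correct : ∀ {n} a s w (ρ : Env n) →
                    ⟦ prepend a s w ⟧ᵣ ρ ≈ signed s (⟦ a ⟧ ρ) ∙ ⟦ w ⟧ᵣ ρ
  prepend-correct (var i) s w ρ = push-correct i s w ρ
  prepend-correct e true  w ρ = sym (identityˡ _)
  prepend-correct e false w ρ = sym (trans (∙-congʳ ε⁻¹≈ε) (identityˡ _))
  prepend-correct (a ⊕ b) true w ρ = begin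
    ⟦ prepend a true (prepend b true w) ⟧ᵣ ρ ≈⟨ prepend-correct a true _ ρ ⟩
    ⟦ a ⟧ ρ ∙ ⟦ prepend b true w ⟧ᵣ ρ        ≈⟨ ∙-congˡ (prepend-correct b true w ρ) ⟩
    ⟦ a ⟧ ρ ∙ (⟦ b ⟧ ρ ∙ ⟦ w ⟧ᵣ ρ)          ≈⟨ assoc _ _ _ ⟨
    ⟦ a ⟧ ρ ∙ ⟦ b ⟧ ρ ∙ ⟦ w ⟧ᵣ ρ            ∎
  prepend-correct (a ⊕ b) false w ρ = begin
    ⟦ prepend b false (prepend a false w) ⟧ᵣ ρ  ≈⟨ prepend-correct b false _ ρ ⟩
    ⟦ b ⟧ ρ ⁻¹ ∙ ⟦ prepend a false w ⟧ᵣ ρ       ≈⟨ ∙-congˡ (prepend-correct a false w ρ) ⟩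
    ⟦ b ⟧ ρ ⁻¹ ∙ (⟦ a ⟧ ρ ⁻¹ ∙ ⟦ w ⟧ᵣ ρ)       ≈⟨ assoc _ _ _ ⟨
    ⟦ b ⟧ ρ ⁻¹ ∙ ⟦ a ⟧ ρ ⁻¹ ∙ ⟦ w ⟧ᵣ ρ         ≈⟨ ∙-congʳ (⁻¹-anti-homo-∙ _ _) ⟨
    (⟦ a ⟧ ρ ∙ ⟦ b ⟧ ρ) ⁻¹ ∙ ⟦ w ⟧ᵣ ρ          ∎
  prepend-correct (⊖ a) true  w ρ = prepend-correct a false w ρ
  prepend-correct (⊖ a) false w ρ =
    trans (prepend-correct a true w ρ) (∙-congʳ (sym (⁻¹-involutive _)))

  ⟦_⇓⟧ : ∀ {n} → Expr n → Env n → Carrier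
  ⟦ a ⇓⟧ ρ = ⟦ prepend a true [] ⟧ᵣ ρ

  correct : ∀ {n} (a : Expr n) ρ → ⟦ a ⇓⟧ ρ ≈ ⟦ a ⟧ ρ
  correct a ρ = trans (prepend-correct a true [] ρ) (identityʳ _)

  open Reflection setoid var ⟦_⟧ ⟦_⇓⟧ correct public using (solve; _⊜_)

-- Counting in finite setoids

⟦_⟧₀₁ : {A : Set p} → Dec A → ℕ
⟦ A? ⟧₀₁ = if does A? then 1 else 0

sum-mono : ∀ {n} {f g : Fin n → ℕ} → (∀ i → f i ≤ g i) → sum f ≤ sum g
sum-mono {zero}  f≤g = z≤n
sum-mono {suc n} f≤g = ℕ.+-mono-≤ (f≤g zero) (sum-mono (f≤g ∘ suc))

term≤sum : ∀ {n} (f : Fin n → ℕ) i → f i ≤ sum f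
term≤sum f zero    = ℕ.m≤m+n _ _
term≤sum f (suc i) = ℕ.≤-trans (term≤sum (f ∘ suc) i) (ℕ.m≤n+m _ _)

sum-indicator≤1 : ∀ {n} {A : Pred (Fin n) p} (A? : Decidable A) →
                  (∀ {i j} → A i → A j → i ≡ j) → sum (⟦_⟧₀₁ ∘ A?) ≤ 1
sum-indicator≤1 {n = zero}  A? unique = z≤n
sum-indicator≤1 {n = suc n} A? unique with A? zero
... | yes a = s≤s (ℕ.≤-reflexive (≡.trans (Σ.sum-cong-≗ others) (Σ.sum-replicate-zero n)))
  where
  others : ∀ i → ⟦ A? (suc i) ⟧₀₁ ≡ 0
  others i with A? (suc i)
  ... | yes b = contradiction (unique a b) λ ()
  ... | no _  = ≡.refl
... | no _  = sum-indicator≤1 (A? ∘ suc) (λ a b → Fin.suc-injective (unique a b))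

module Counting {c ℓ} (S : Setoid c ℓ) {n} (enum : Inverse (≡.setoid (Fin n)) S) where
  open Setoid S
  open Inverse enum using (to; from; from-cong; strictlyInverseˡ; strictlyInverseʳ)

  infix 4 _≟_
  _≟_ : ∀ x y → Dec (x ≈ y)
  x ≟ y = Dec.map′
    (λ eq → trans (sym (strictlyInverseˡ x)) (trans (reflexive (≡.cong to eq)) (strictlyInverseˡ y)))
    from-cong (from x Fin.≟ from y)

  any? : {A : Pred Carrier p} → A Respects _≈_ → Decidable A → Dec (∃ A)
  any? resp A? = Dec.map′
    (λ (i , a) → to i , a)
    (λ (x , a) → from x , resp (sym (strictlyInverseˡ x)) a)
    (Fin.any? (A? ∘ to))

  all? : {A : Pred Carrier p} → A Respects _≈_ → Decidable A → Dec (∀ x → A x)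
  all? resp A? = Dec.map′
    (λ a x → resp (strictlyInverseˡ x) (a (from x)))
    (λ a i → a (to i))
    (Fin.all? (A? ∘ to))

  # : {A : Pred Carrier p} → Decidable A → ℕ
  # A? = sum (λ i → ⟦ A? (to i) ⟧₀₁)

  #-≤1 : {A : Pred Carrier p} (A? : Decidable A) → (∀ {x y} → A x → A y → x ≈ y) → # A? ≤ 1
  #-≤1 A? unique = sum-indicator≤1 (A? ∘ to) λ a b →
    ≡.trans (≡.sym (strictlyInverseʳ _)) (≡.trans (from-cong (unique a b)) (strictlyInverseʳ _))

  #-positive : {A : Pred Carrier p} (A? : Decidable A) → A Respects _≈_ → ∀ {x} → A x → 1 ≤ # A?
  #-positive A? resp {x} a = ℕ.≤-trans one (term≤sum _ (from x))
    where
    one : 1 ≤ ⟦ A? (to (from x)) ⟧₀₁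
    one with A? (to (from x))
    ... | yes _ = s≤s z≤n
    ... | no ¬a = contradiction (resp (sym (strictlyInverseˡ x)) a) ¬a

  #-mono : {A : Pred Carrier p} {B : Pred Carrier q} (A? : Decidable A) (B? : Decidable B) →
           (∀ {x} → A x → B x) → # A? ≤ # B?
  #-mono A? B? A⊆B = sum-mono (λ i → pointwise (to i))
    where
    pointwise : ∀ x → ⟦ A? x ⟧₀₁ ≤ ⟦ B? x ⟧₀₁
    pointwise x with A? x | B? x
    ... | no _  | _     = z≤n
    ... | yes _ | yes _ = s≤s z≤n
    ... | yes a | no ¬b = contradiction (A⊆B a) ¬b

  #-cong : {A : Pred Carrier p} {B : Pred Carrier q} (A? : Decidable A) (B? : Decidable B) →
           (∀ {x} → A x → B x) → (∀ {x} → B x → A x) → # A? ≡ # B?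
  #-cong A? B? A⊆B B⊆A = ℕ.≤-antisym (#-mono A? B? A⊆B) (#-mono B? A? B⊆A)

  #-empty : {A : Pred Carrier p} (A? : Decidable A) → (∀ {x} → ¬ A x) → # A? ≡ 0
  #-empty A? empty = ≡.trans (Σ.sum-cong-≗ (λ i → pointwise (to i))) (Σ.sum-replicate-zero n)
    where
    pointwise : ∀ x → ⟦ A? x ⟧₀₁ ≡ 0
    pointwise x with A? x
    ... | yes a = contradiction a empty
    ... | no _  = ≡.refl

  #-split : {A : Pred Carrier p} {B : Pred Carrier q} (A? : Decidable A) (B? : Decidable B) →
            # A? ≡ # (A? ∩? B?) + # (A? ∩? ∁? B?)
  #-split A? B? = ≡.trans (Σ.sum-cong-≗ (λ i → pointwise (to i)))
                          (Σ.∑-distrib-+ {n} _ _)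
    where
    pointwise : ∀ x → ⟦ A? x ⟧₀₁ ≡ ⟦ (A? ∩? B?) x ⟧₀₁ + ⟦ (A? ∩? ∁? B?) x ⟧₀₁
    pointwise x with A? x | B? x
    ... | yes _ | yes _ = ≡.refl
    ... | yes _ | no _  = ≡.refl
    ... | no _  | yes _ = ≡.refl
    ... | no _  | no _  = ≡.refl

  #-strict : {A : Pred Carrier p} {B : Pred Carrier q} (A? : Decidable A) (B? : Decidable B) →
             A Respects _≈_ → B Respects _≈_ →
             (∀ {x} → A x → B x) → ∀ {x} → B x → ¬ A x → # A? < # B?
  #-strict {A = A} {B} A? B? respA respB A⊆B {x} b ¬a = begin-strict
    # A?                                <⟨ ℕ.m<m+n (# A?) positive ⟩
    # A? + # (B? ∩? ∁? A?)              ≡⟨ ≡.cong (_+ # (B? ∩? ∁? A?))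
                                              (#-cong A? (B? ∩? A?) (λ a → A⊆B a , a) proj₂) ⟩
    # (B? ∩? A?) + # (B? ∩? ∁? A?)      ≡⟨ #-split B? A? ⟨
    # B?                                ∎
    where
    open ℕ.≤-Reasoning
    positive : 1 ≤ # (B? ∩? ∁? A?)
    positive = #-positive (B? ∩? ∁? A?)
      (λ x≈y (b , ¬a) → respB x≈y b , λ a → ¬a (respA (sym x≈y) a)) (b , ¬a)

-- Double counting of incidences

module DoubleCounting
  {c ℓ c′ ℓ′} (S : Setoid c ℓ) {m} (enumS : Inverse (≡.setoid (Fin m)) S)
  (T : Setoid c′ ℓ′) {n} (enumT : Inverse (≡.setoid (Fin n)) T) where
  private
    module S where
      open Setoid S public
      open Counting S enumS public
      open Inverse enumS public using (to)
    module T where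
      open Setoid T public
      open Counting T enumT public
      open Inverse enumT public using (to)

  -- Both sides bound the number of pairs in `M`, summed by rows and by columns; columns outside `B`
  -- are empty. Equalities come from applying it in both directions.
  double-counting : {A : Pred S.Carrier p} {B : Pred T.Carrier q} {M : REL S.Carrier T.Carrier r}
    (A? : Decidable A) (B? : Decidable B) (M? : ∀ x y → Dec (M x y)) → ∀ {a b} →
    (∀ {x y} → M x y → B y) →
    (∀ {x} → A x → a ≤ T.# (M? x)) →
    (∀ {y} → B y → S.# (λ x → M? x y) ≤ b) →
    S.# A? * a ≤ T.# B? * b
  double-counting {A = A} {B} A? B? M? {a} {b} M⊆B row column = begin
    S.# A? * a                                               ≡⟨ Σ.*-distribʳ-sum {m} a _ ⟩
    sum (λ i → ⟦ A? (S.to i) ⟧₀₁ * a)                        ≤⟨ sum-mono (λ i → row′ (S.to i)) ⟩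
    sum (λ i → T.# (M? (S.to i)))                            ≡⟨ Σ.∑-comm {m} {n} _ ⟩
    sum (λ j → S.# (λ x → M? x (T.to j)))                    ≤⟨ sum-mono (λ j → column′ (T.to j)) ⟩
    sum (λ j → ⟦ B? (T.to j) ⟧₀₁ * b)                        ≡⟨ Σ.*-distribʳ-sum {n} b _ ⟨
    T.# B? * b                                               ∎
    where
    open ℕ.≤-Reasoning
    row′ : ∀ x → ⟦ A? x ⟧₀₁ * a ≤ T.# (M? x)
    row′ x with A? x
    ... | yes x∈A = ℕ.≤-trans (ℕ.≤-reflexive (ℕ.*-identityˡ a)) (row x∈A)
    ... | no _    = z≤n
    column′ : ∀ y → S.# (λ x → M? x y) ≤ ⟦ B? y ⟧₀₁ * b
    column′ y with B? y
    ... | yes y∈B = ℕ.≤-trans (column y∈B) (ℕ.≤-reflexive (≡.sym (ℕ.*-identityˡ b)))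
    ... | no y∉B  = ℕ.≤-reflexive (S.#-empty (λ x → M? x y) (λ Mxy → y∉B (M⊆B Mxy)))

  #-injection : {A : Pred S.Carrier p} {B : Pred T.Carrier q}
    (A? : Decidable A) (B? : Decidable B) → B Respects T._≈_ →
    (f : S.Carrier → T.Carrier) → (∀ {x} → A x → B (f x)) →
    (∀ {x y} → A x → A y → f x T.≈ f y → x S.≈ y) →
    S.# A? ≤ T.# B?
  #-injection {A = A} {B} A? B? resp f maps injective = begin
    S.# A?     ≡⟨ ℕ.*-identityʳ _ ⟨
    S.# A? * 1 ≤⟨ double-counting A? B? M? (λ (a , fx≈y) → resp fx≈y (maps a))
                    (λ {x} a → T.#-positive (M? x) (λ y≈z (a , fx≈y) → a , T.trans fx≈y y≈z) (a , T.refl))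
                    (λ {y} _ → S.#-≤1 (λ x → M? x y) λ (a , fx≈y) (b , fx′≈y) →
                       injective a b (T.trans fx≈y (T.sym fx′≈y))) ⟩
    T.# B? * 1 ≡⟨ ℕ.*-identityʳ _ ⟩
    T.# B?     ∎
    where
    open ℕ.≤-Reasoning
    M? : ∀ x y → Dec (A x × f x T.≈ y)
    M? x y = A? x ×-dec (f x T.≟ y)

-- An odd divisor of `2 ^ suc k` is coprime to 2, hence already divides `2 ^ k`.
∣2^k⇒≡1⊎even : ∀ k {d} → d ∣ 2 ^ k → d ≡ 1 ⊎ 2 ∣ d
∣2^k⇒≡1⊎even zero {d} d∣1 = inj₁ (∣1⇒≡1 d∣1)
∣2^k⇒≡1⊎even (suc k) {d} d∣2^1+k with 2 ∣? d
... | yes 2∣d = inj₂ 2∣d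
... | no 2∤d = ∣2^k⇒≡1⊎even k (coprime-divisor coprime d∣2^1+k)
  where
  coprime : Coprime d 2
  coprime (j∣d , j∣2) with irreducible[2] j∣2
  ... | inj₁ j≡1    = j≡1
  ... | inj₂ ≡.refl = contradiction j∣d 2∤d

-- Counting cosets

module CosetCounting {c ℓ} (G : Group c ℓ) {n} (order : HasOrder G n) where
  open Group G
  open FreeGroupSolver G using (solve; _⊜_; _⊕_; ⊖_; e)
  open Counting setoid order public
  open DoubleCounting setoid order setoid order public

  #-bijection : {A : Pred Carrier p} (A? : Decidable A) → A Respects _≈_ →
                (f g : Carrier → Carrier) →
                (∀ {x y} → x ≈ y → f x ≈ f y) → (∀ {x y} → x ≈ y → g x ≈ g y) →
                (∀ x → f (g x) ≈ x) → (∀ x → g (f x) ≈ x) → # (A? ∘ f) ≡ # A?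
  #-bijection A? resp f g f-cong g-cong fg gf = ℕ.≤-antisym
    (#-injection (A? ∘ f) A? resp f id
      (λ {x} {y} _ _ fx≈fy → trans (sym (gf x)) (trans (g-cong fx≈fy) (gf y))))
    (#-injection A? (A? ∘ f) (resp ∘ f-cong) g (λ {x} → resp (sym (fg x)))
      (λ {x} {y} _ _ gx≈gy → trans (sym (fg x)) (trans (f-cong gx≈gy) (fg y))))

  #-translateˡ : {A : Pred Carrier p} (A? : Decidable A) → A Respects _≈_ →
                 ∀ g → # (A? ∘ (g ∙_)) ≡ # A?
  #-translateˡ A? resp g = #-bijection A? resp (g ∙_) (g ⁻¹ ∙_) ∙-congˡ ∙-congˡ
    (λ x → solve 2 (λ g x → g ⊕ (⊖ g ⊕ x) ⊜ x) refl g x)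
    (λ x → solve 2 (λ g x → ⊖ g ⊕ (g ⊕ x) ⊜ x) refl g x)

  #-translateʳ : {A : Pred Carrier p} (A? : Decidable A) → A Respects _≈_ →
                 ∀ g → # (A? ∘ (_∙ g)) ≡ # A?
  #-translateʳ A? resp g = #-bijection A? resp (_∙ g) (_∙ g ⁻¹) ∙-congʳ ∙-congʳ
    (λ x → solve 2 (λ g x → x ⊕ ⊖ g ⊕ g ⊜ x) refl g x)
    (λ x → solve 2 (λ g x → x ⊕ g ⊕ ⊖ g ⊜ x) refl g x)

  -- Splits off one class at a time. The equivalence laws are asked for on `A` only, because
  -- relations built from a map on `A` satisfy them only there.
  ∣#-partition : ∀ {d} {A : Pred Carrier p} {_∼_ : Rel Carrier p}
    (A? : Decidable A) (_∼?_ : ∀ x y → Dec (x ∼ y)) →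
    A Respects _≈_ → (∀ {x} → (x ∼_) Respects _≈_) →
    (∀ {x} → A x → x ∼ x) →
    (∀ {x y} → A x → A y → x ∼ y → y ∼ x) →
    (∀ {x y z} → A x → A y → A z → x ∼ y → y ∼ z → x ∼ z) →
    (∀ {x} → A x → d ∣ # (A? ∩? (x ∼?_))) → d ∣ # A?
  ∣#-partition {p = p} {d = d} {A₀} {_∼_} A₀? _∼?_ respA resp∼ ∼-refl ∼-sym ∼-trans =
    bounded _ A₀? respA id (ℕ.n<1+n _)
    where
    -- Induction on a bound for the size: `A` shrinks, while the laws of the relation stay tied to
    -- the original `A₀`.
    bounded : ∀ m {A : Pred Carrier p} (A? : Decidable A) → A Respects _≈_ →
              (∀ {x} → A x → A₀ x) → # A? < m →
              (∀ {x} → A x → d ∣ # (A? ∩? (x ∼?_))) → d ∣ # A?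
    bounded (suc m) {A} A? resp A⊆A₀ (s≤s #A≤m) classes with any? resp A?
    ... | no empty = ≡.subst (d ∣_) (≡.sym (#-empty A? λ {x} a → empty (x , a))) (d ∣0)
    ... | yes (x , a) = ≡.subst (d ∣_) (≡.sym (#-split A? (x ∼?_)))
      (∣m∣n⇒∣m+n (classes a) (bounded m rest? rest-resp (A⊆A₀ ∘ proj₁) smaller rest-classes))
      where
      rest? = A? ∩? ∁? (x ∼?_)
      rest-resp : (A ∩ ∁ (x ∼_)) Respects _≈_
      rest-resp y≈z (b , x≁y) = resp y≈z b , λ x∼z → x≁y (resp∼ (sym y≈z) x∼z)
      smaller : # rest? < m
      smaller = ℕ.<-≤-trans
        (#-strict rest? A? rest-resp resp proj₁ a (λ (_ , x≁x) → x≁x (∼-refl (A⊆A₀ a)))) #A≤m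
      -- Nothing related to `y` is related to `x`, so removing the class of `x` leaves the class of
      -- `y` whole.
      rest-classes : ∀ {y} → (A ∩ ∁ (x ∼_)) y → d ∣ # (rest? ∩? (y ∼?_))
      rest-classes {y} (b , x≁y) = ≡.subst (d ∣_)
        (#-cong (A? ∩? (y ∼?_)) (rest? ∩? (y ∼?_))
          (λ (a′ , y∼z) → (a′ , λ x∼z → x≁y (∼-trans (A⊆A₀ a) (A⊆A₀ a′) (A⊆A₀ b) x∼z
                                         (∼-sym (A⊆A₀ b) (A⊆A₀ a′) y∼z))) , y∼z)
          (λ ((a′ , _) , y∼z) → a′ , y∼z))
        (classes b)

  -- Rx = Ry
  _⊢_∼_ : Subgroup G → Rel Carrier (c ⊔ ℓ)
  R ⊢ x ∼ y = member R (y ∙ x ⁻¹)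

  module Mod (R : Subgroup G) where
    open Subgroup R

    ∼-resp : ∀ {x} → (R ⊢ x ∼_) Respects _≈_
    ∼-resp y≈z = resp (∙-congʳ y≈z)

    ∼-reflexive : ∀ {x y} → x ≈ y → R ⊢ x ∼ y
    ∼-reflexive {x} x≈y = ∼-resp x≈y (resp (sym (inverseʳ x)) ε∈)

    ∼-refl : ∀ {x} → R ⊢ x ∼ x
    ∼-refl = ∼-reflexive refl

    ∼-sym : ∀ {x y} → R ⊢ x ∼ y → R ⊢ y ∼ x
    ∼-sym {x} {y} x∼y =
      resp (solve 2 (λ x y → ⊖ (y ⊕ ⊖ x) ⊜ x ⊕ ⊖ y) refl x y) (⁻¹∈ x∼y)

    ∼-trans : ∀ {x y z} → R ⊢ x ∼ y → R ⊢ y ∼ z → R ⊢ x ∼ z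
    ∼-trans {x} {y} {z} x∼y y∼z =
      resp (solve 3 (λ x y z → z ⊕ ⊖ y ⊕ (y ⊕ ⊖ x) ⊜ z ⊕ ⊖ x) refl x y z) (∙∈ y∼z x∼y)

    ∙-∼ : ∀ {r} x → member R r → R ⊢ x ∼ (r ∙ x)
    ∙-∼ {r} x r∈R = resp (solve 2 (λ r x → r ⊜ r ⊕ x ⊕ ⊖ x) refl r x) r∈R

    ∼-∙ʳ : ∀ {x y} z → R ⊢ x ∼ y → R ⊢ (x ∙ z) ∼ (y ∙ z)
    ∼-∙ʳ {x} {y} z = resp (solve 3 (λ x y z → y ⊕ ⊖ x ⊜ y ⊕ z ⊕ ⊖ (x ⊕ z)) refl x y z)

    ∼⇒∈ : ∀ {x y} → R ⊢ x ∼ y → member R x → member R y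
    ∼⇒∈ {x} {y} x∼y x∈R = resp (solve 2 (λ x y → y ⊕ ⊖ x ⊕ x ⊜ y) refl x y) (∙∈ x∼y x∈R)

  #-coset : ∀ (R : Subgroup G) (R? : Decidable (member R)) x → # (λ y → R? (y ∙ x ⁻¹)) ≡ # R?
  #-coset R R? x = #-translateʳ R? (Subgroup.resp R) (x ⁻¹)

  lagrange : ∀ {K L : Subgroup G} (K? : Decidable (member K)) (L? : Decidable (member L)) →
             (∀ {x} → member K x → member L x) → # K? ∣ # L?
  lagrange {K} {L} K? L? K⊆L =
    ∣#-partition L? (λ x y → K? (y ∙ x ⁻¹)) (Subgroup.resp L) ∼-resp
      (λ _ → ∼-refl) (λ _ _ → ∼-sym) (λ _ _ _ → ∼-trans) λ {x} x∈L →
        ∣-reflexive (≡.trans (≡.sym (#-coset K K? x))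
          (#-cong (λ y → K? (y ∙ x ⁻¹)) (L? ∩? (λ y → K? (y ∙ x ⁻¹)))
            (λ x∼y → Mod.∼⇒∈ L (K⊆L x∼y) x∈L , x∼y) proj₂))
    where open Mod K

  #-subgroup-positive : ∀ (R : Subgroup G) (R? : Decidable (member R)) → 1 ≤ # R?
  #-subgroup-positive R R? = #-positive R? (Subgroup.resp R) (Subgroup.ε∈ R)

  -- Sizes of double cosets

  module DoubleCosets (R K : Subgroup G) (R? : Decidable (member R)) (K? : Decidable (member K)) where
    private
      module R = Subgroup R
      module K = Subgroup K

    -- The factor from `K` is determined by `r`, so one existential suffices and a search over `r`
    -- decides it.
    RgK : Rel Carrier (c ⊔ ℓ)
    RgK g y = ∃ λ r → member R r × member K ((r ∙ g) ⁻¹ ∙ y)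

    RgK-resp : ∀ {g} → RgK g Respects _≈_
    RgK-resp y≈z (r , r∈R , k∈K) = r , r∈R , K.resp (∙-congˡ y≈z) k∈K

    RgK? : ∀ g y → Dec (RgK g y)
    RgK? g y = any?
      (λ r≈s (r∈R , k∈K) → R.resp r≈s r∈R , K.resp (∙-congʳ (⁻¹-cong (∙-congʳ r≈s))) k∈K)
      (λ r → R? r ×-dec K? ((r ∙ g) ⁻¹ ∙ y))

    RgK-intro : ∀ {r k} g → member R r → member K k → RgK g (r ∙ g ∙ k)
    RgK-intro {r} {k} g r∈R k∈K =
      r , r∈R , K.resp (solve 3 (λ r g k → k ⊜ ⊖ (r ⊕ g) ⊕ (r ⊕ g ⊕ k)) refl r g k) k∈K

    RgK-refl : ∀ {g} → RgK g g
    RgK-refl {g} =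
      RgK-resp (solve 1 (λ g → e ⊕ g ⊕ e ⊜ g) refl g) (RgK-intro g R.ε∈ K.ε∈)

    RgK-sym : ∀ {g y} → RgK g y → RgK y g
    RgK-sym {g} {y} (r , r∈R , k∈K) = RgK-resp
      (solve 3 (λ r g y → ⊖ r ⊕ y ⊕ ⊖ (⊖ (r ⊕ g) ⊕ y) ⊜ g) refl r g y)
      (RgK-intro y (R.⁻¹∈ r∈R) (K.⁻¹∈ k∈K))

    RgK-trans : ∀ {g y z} → RgK g y → RgK y z → RgK g z
    RgK-trans {g} {y} {z} (r , r∈R , k∈K) (s , s∈R , l∈K) = RgK-resp
      (solve 5 (λ r s g y z → s ⊕ r ⊕ g ⊕ (⊖ (r ⊕ g) ⊕ y ⊕ (⊖ (s ⊕ y) ⊕ z)) ⊜ z) refl r s g y z)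
      (RgK-intro g (R.∙∈ s∈R r∈R) (K.∙∈ k∈K l∈K))

    conjugate-∈? : ∀ g → Dec (∀ r → member R r → member K (g ⁻¹ ∙ r ∙ g))
    conjugate-∈? g = all?
      (λ r≈s f s∈R → K.resp (∙-congʳ (∙-congˡ r≈s)) (f (R.resp (sym r≈s) s∈R)))
      (λ r → R? r →-dec K? (g ⁻¹ ∙ r ∙ g))

    module _ (g : Carrier) where
      -- This is `R ∩ gKg⁻¹`, the stabilizer in `R` of the left coset `gK`.
      stabilizer : Subgroup G
      stabilizer = record
        { member = λ r → member R r × member K (g ⁻¹ ∙ r ∙ g)
        ; resp   = λ r≈s (r∈R , k∈K) → R.resp r≈s r∈R , K.resp (∙-congʳ (∙-congˡ r≈s)) k∈K
        ; ε∈     = R.ε∈ , K.resp (solve 1 (λ g → e ⊜ ⊖ g ⊕ e ⊕ g) refl g) K.ε∈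
        ; ∙∈     = λ {r} {s} (r∈R , k∈K) (s∈R , l∈K) → R.∙∈ r∈R s∈R ,
            K.resp (solve 3 (λ g r s → ⊖ g ⊕ r ⊕ g ⊕ (⊖ g ⊕ s ⊕ g) ⊜ ⊖ g ⊕ (r ⊕ s) ⊕ g) refl g r s)
              (K.∙∈ k∈K l∈K)
        ; ⁻¹∈    = λ {r} (r∈R , k∈K) → R.⁻¹∈ r∈R ,
            K.resp (solve 2 (λ g r → ⊖ (⊖ g ⊕ r ⊕ g) ⊜ ⊖ g ⊕ ⊖ r ⊕ g) refl g r) (K.⁻¹∈ k∈K)
        }

      stabilizer? : Decidable (member stabilizer)
      stabilizer? r = R? r ×-dec K? (g ⁻¹ ∙ r ∙ g)

      private
        Incident : Rel Carrier (c ⊔ ℓ)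
        Incident r y = member R r × member K ((r ∙ g) ⁻¹ ∙ y)

        Incident? : ∀ r y → Dec (Incident r y)
        Incident? r y = R? r ×-dec K? ((r ∙ g) ⁻¹ ∙ y)

        row : ∀ {r} → member R r → # (Incident? r) ≡ # K?
        row {r} r∈R = ≡.trans
          (#-cong (Incident? r) (K? ∘ ((r ∙ g) ⁻¹ ∙_)) proj₂ (r∈R ,_))
          (#-translateˡ K? K.resp ((r ∙ g) ⁻¹))

        -- The `r` with `y ∈ rgK` form the left coset of the stabilizer through the one solution
        -- `s`.
        column : ∀ {y} → RgK g y → # (λ r → Incident? r y) ≡ # stabilizer?
        column {y} (s , s∈R , l∈K) = ≡.trans
          (#-cong (λ r → Incident? r y) (stabilizer? ∘ (s ⁻¹ ∙_))
            (λ {r} (r∈R , k∈K) → R.∙∈ (R.⁻¹∈ s∈R) r∈R ,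
               K.resp (solve 4 (λ g r s y → ⊖ (s ⊕ g) ⊕ y ⊕ ⊖ (⊖ (r ⊕ g) ⊕ y) ⊜ ⊖ g ⊕ (⊖ s ⊕ r) ⊕ g)
                         refl g r s y)
                 (K.∙∈ l∈K (K.⁻¹∈ k∈K)))
            (λ {r} (s⁻¹r∈R , m∈K) →
               R.resp (solve 2 (λ r s → s ⊕ (⊖ s ⊕ r) ⊜ r) refl r s) (R.∙∈ s∈R s⁻¹r∈R) ,
               K.resp (solve 4 (λ g r s y → ⊖ (⊖ g ⊕ (⊖ s ⊕ r) ⊕ g) ⊕ (⊖ (s ⊕ g) ⊕ y) ⊜ ⊖ (r ⊕ g) ⊕ y)
                         refl g r s y)
                 (K.∙∈ (K.⁻¹∈ m∈K) l∈K)))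
          (#-translateˡ stabilizer? (Subgroup.resp stabilizer) (s ⁻¹))

      -- Counts the pairs `(r , y)` with `y ∈ rgK`: each `r` in `R` has |K| partners, and each `y`
      -- in `RgK` has as many as the stabilizer has elements.
      #-double-coset : # R? * # K? ≡ # (RgK? g) * # stabilizer?
      #-double-coset = ℕ.≤-antisym
        (double-counting R? (RgK? g) Incident? (λ {r} (r∈R , k∈K) → r , r∈R , k∈K)
          (λ r∈R → ℕ.≤-reflexive (≡.sym (row r∈R))) (λ y∈ → ℕ.≤-reflexive (column y∈)))
        (double-counting (RgK? g) R? (λ y r → Incident? r y) proj₁
          (λ y∈ → ℕ.≤-reflexive (≡.sym (column y∈))) (λ r∈R → ℕ.≤-reflexive (row r∈R)))

      -- The number of left cosets of `K` in `RgK` is the index of the stabilizer in `R`. It divides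
      -- a power of 2, so it is even or 1, and index 1 would put `R` inside `gKg⁻¹`.
      double-coset-even : ∀ {k} → # R? ∣ 2 ^ k → ¬ (∀ r → member R r → member K (g ⁻¹ ∙ r ∙ g)) →
                          2 * # K? ∣ # (RgK? g)
      double-coset-even {k} #R∣2^k ¬conj
        with lagrange {stabilizer} {R} stabilizer? R? proj₁
      ... | divides q #R≡q*#W with ∣2^k⇒≡1⊎even k
              (∣-trans (divides (# stabilizer?) (≡.trans #R≡q*#W (ℕ.*-comm q _))) #R∣2^k)
      ... | inj₁ ≡.refl = contradiction conj ¬conj
        where
        conj : ∀ r → member R r → member K (g ⁻¹ ∙ r ∙ g)
        conj r r∈R with stabilizer? r
        ... | yes (_ , k∈K) = k∈K
        ... | no r∉W = contradiction
          (≡.trans (≡.sym (ℕ.*-identityˡ _)) (≡.sym #R≡q*#W))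
          (ℕ.<⇒≢ (#-strict stabilizer? R? (Subgroup.resp stabilizer) R.resp proj₁ r∈R r∉W))
      ... | inj₂ (divides j ≡.refl) = divides j (ℕ.*-cancelʳ-≡ _ _ (# stabilizer?) (begin
        # (RgK? g) * w       ≡⟨ #-double-coset ⟨
        # R? * # K?          ≡⟨ ≡.cong (_* # K?) #R≡q*#W ⟩
        j * 2 * w * # K?     ≡⟨ rearrange j w (# K?) ⟩
        j * (2 * # K?) * w   ∎))
        where
        open ≡.≡-Reasoning
        w = # stabilizer?
        instance
          w≢0 : NonZero w
          w≢0 = >-nonZero (#-subgroup-positive stabilizer stabilizer?)
        rearrange : ∀ j w k → j * 2 * w * k ≡ j * (2 * k) * w
        rearrange = solve-∀

    -- A = RAK is the disjoint union of double cosets RgK, each of even index over K unless gKg⁻¹ contains R.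
    ∣#-without-conjugates : ∀ {k} → # R? ∣ 2 ^ k →
      {A : Pred Carrier (c ⊔ ℓ)} (A? : Decidable A) → A Respects _≈_ →
      (∀ {r x} → member R r → A x → A (r ∙ x)) →
      (∀ {k x} → member K k → A x → A (x ∙ k)) →
      (∀ {g} → A g → ¬ (∀ r → member R r → member K (g ⁻¹ ∙ r ∙ g))) →
      2 * # K? ∣ # A?
    ∣#-without-conjugates {k} #R∣2^k {A} A? resp RA AK ¬conj =
      ∣#-partition A? RgK? resp RgK-resp (λ _ → RgK-refl) (λ _ _ → RgK-sym) (λ _ _ _ → RgK-trans)
        λ {g} g∈A → ≡.subst (2 * # K? ∣_)
          (#-cong (RgK? g) (A? ∩? RgK? g) (λ {y} (r , r∈R , k∈K) →
             resp (solve 3 (λ r g y → r ⊕ (g ⊕ (⊖ (r ⊕ g) ⊕ y)) ⊜ y) refl r g y)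
               (RA r∈R (AK k∈K g∈A)) , r , r∈R , k∈K) proj₂)
          (double-coset-even g {k} #R∣2^k (¬conj g∈A))

  -- ι induces a fixed-point-free involution on the right cosets of R in A, which therefore pair up.
  ∣#-free-involution : ∀ (R : Subgroup G) (R? : Decidable (member R))
    {A : Pred Carrier (c ⊔ ℓ)} (A? : Decidable A) →
    A Respects _≈_ → (∀ {x y} → R ⊢ x ∼ y → A x → A y) →
    (ι : Carrier → Carrier) →
    (∀ {x} → A x → A (ι x)) →
    (∀ {x y} → A x → R ⊢ x ∼ y → R ⊢ ι x ∼ ι y) →
    (∀ {x} → A x → R ⊢ ι (ι x) ∼ x) →
    (∀ {x} → A x → ¬ R ⊢ ι x ∼ x) →
    2 * # R? ∣ # A?
  ∣#-free-involution R R? {A} A? resp RA ι ιA ι-cong ι-involutive free =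
    ∣#-partition A? linked? resp linked-resp (λ _ → inj₁ ∼-refl) linked-sym linked-trans classes
    where
    open Mod R
    coset? : ∀ x y → Dec (R ⊢ x ∼ y)
    coset? x y = R? (y ∙ x ⁻¹)
    Linked : Rel Carrier (c ⊔ ℓ)
    Linked x y = R ⊢ x ∼ y ⊎ R ⊢ ι x ∼ y
    linked? : ∀ x y → Dec (Linked x y)
    linked? x y = coset? x y ⊎-dec coset? (ι x) y
    linked-resp : ∀ {x} → Linked x Respects _≈_
    linked-resp y≈z (inj₁ x∼y) = inj₁ (∼-resp y≈z x∼y)
    linked-resp y≈z (inj₂ ιx∼y) = inj₂ (∼-resp y≈z ιx∼y)
    linked-sym : ∀ {x y} → A x → A y → Linked x y → Linked y x
    linked-sym a b (inj₁ x∼y) = inj₁ (∼-sym x∼y)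
    linked-sym a b (inj₂ ιx∼y) = inj₂ (∼-trans (∼-sym (ι-cong (ιA a) ιx∼y)) (ι-involutive a))
    linked-trans : ∀ {x y z} → A x → A y → A z → Linked x y → Linked y z → Linked x z
    linked-trans a b _ (inj₁ x∼y) (inj₁ y∼z) = inj₁ (∼-trans x∼y y∼z)
    linked-trans a b _ (inj₁ x∼y) (inj₂ ιy∼z) = inj₂ (∼-trans (ι-cong a x∼y) ιy∼z)
    linked-trans a b _ (inj₂ ιx∼y) (inj₁ y∼z) = inj₂ (∼-trans ιx∼y y∼z)
    linked-trans a b _ (inj₂ ιx∼y) (inj₂ ιy∼z) =
      inj₁ (∼-trans (∼-sym (ι-involutive a)) (∼-trans (ι-cong (ιA a) ιx∼y) ιy∼z))
    -- The class of `x` consists of the cosets of `x` and `ι x`, which are disjoint because `ι`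
    -- fixes no coset.
    classes : ∀ {x} → A x → 2 * # R? ∣ # (A? ∩? linked? x)
    classes {x} a = ∣-reflexive (≡.sym (begin
      # (A? ∩? linked? x)
        ≡⟨ #-split (A? ∩? linked? x) (coset? x) ⟩
      # ((A? ∩? linked? x) ∩? coset? x) + # ((A? ∩? linked? x) ∩? ∁? (coset? x))
        ≡⟨ ≡.cong₂ _+_
             (#-cong ((A? ∩? linked? x) ∩? coset? x) (coset? x) proj₂ (λ x∼y → (RA x∼y a , inj₁ x∼y) , x∼y))
             (#-cong ((A? ∩? linked? x) ∩? ∁? (coset? x)) (coset? (ι x)) other
               (λ ιx∼y → (RA ιx∼y (ιA a) , inj₂ ιx∼y) , λ x∼y → free a (∼-trans ιx∼y (∼-sym x∼y)))) ⟩
      # (coset? x) + # (coset? (ι x))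
        ≡⟨ ≡.cong₂ _+_ (#-coset R R? x) (#-coset R R? (ι x)) ⟩
      # R? + # R?
        ≡⟨ ≡.cong (# R? +_) (ℕ.+-identityʳ _) ⟨
      2 * # R? ∎))
      where
      open ≡.≡-Reasoning
      other : ∀ {y} → (A y × Linked x y) × ¬ R ⊢ x ∼ y → R ⊢ ι x ∼ y
      other ((_ , inj₁ x∼y) , x≁y) = contradiction x∼y x≁y
      other ((_ , inj₂ ιx∼y) , _) = ιx∼y

-- Perfect codes and inverse-closed right transversals

module Transversals {c ℓ} (G : Group c ℓ) {n} (order : HasOrder G n)
  (H : Subgroup G) (H? : Decidable (member H)) where
  open Group G
  open GroupProperties G
  open FreeGroupSolver G using (solve; _⊜_; _⊕_; ⊖_; e)
  open CosetCounting G order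
  open Mod H
  private module H = Subgroup H

  self-inverse : ∀ {t} → t ≈ t ⁻¹ → t ∙ t ≈ ε
  self-inverse {t} t≈t⁻¹ = trans (∙-congˡ t≈t⁻¹) (inverseʳ t)

  record PartialTransversal : Set (lsuc (c ⊔ ℓ)) where
    field
      rep      : Pred Carrier (c ⊔ ℓ)
      rep-resp : rep Respects _≈_
      rep-⁻¹   : ∀ {t} → rep t → rep (t ⁻¹)
      distinct : ∀ {s t} → rep s → rep t → H ⊢ s ∼ t → s ≈ t

    Covered : Pred Carrier (c ⊔ ℓ)
    Covered x = ∃ λ t → rep t × H ⊢ x ∼ t

    Covered-∼ : ∀ {x y} → H ⊢ x ∼ y → Covered x → Covered y
    Covered-∼ x∼y (t , t∈T , x∼t) = t , t∈T , ∼-trans (∼-sym x∼y) x∼t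

    Covered-resp : Covered Respects _≈_
    Covered-resp = Covered-∼ ∘ ∼-reflexive

    Complete : Set (c ⊔ ℓ)
    Complete = ∀ x → Covered x

    covered? : Decidable rep → Decidable Covered
    covered? rep? x = any? (λ s≈t (s∈T , x∼s) → rep-resp s≈t s∈T , ∼-resp s≈t x∼s)
      (λ t → rep? t ×-dec H? (t ∙ x ⁻¹))

  open PartialTransversal

  -- Take T = S ∪ {ε}. Since `y` is within distance 1 of `x` exactly when `y ∙ x ⁻¹` lies in T, the
  -- code vertex `y` near `x ⁻¹` yields the representative `yx` of `Hx`.
  perfect-code⇒transversal : IsPerfectCodeOf G H → ∃ Complete
  perfect-code⇒transversal (S , code) = T , complete
    where
    module S = ConnectionSet S
    open IsPerfectCode code

    near : ∀ {s} → s ≈ ε ⊎ S.member s → ∀ {x y} → y ∙ x ⁻¹ ≈ s → DistanceAtMost (Cay G S) 1 x y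
    near (inj₁ s≈ε) {x} {y} eq = 0 , z≤n ,
      nil (sym (x∙y⁻¹≈ε⇒x≈y y x (trans eq s≈ε)))
    near (inj₂ s∈S) eq = 1 , s≤s z≤n , step (S.resp (sym eq) s∈S) (nil refl)

    far : ∀ {x y} → DistanceAtMost (Cay G S) 1 x y → y ∙ x ⁻¹ ≈ ε ⊎ S.member (y ∙ x ⁻¹)
    far {x} (_ , _ , nil x≈y) = inj₁ (trans (∙-congʳ (sym x≈y)) (inverseʳ x))
    far (_ , _ , step s∈S (nil y≈z)) = inj₂ (S.resp (∙-congʳ y≈z) s∈S)
    far (_ , s≤s () , step _ (step _ _))

    T : PartialTransversal
    T = record
      { rep      = λ s → s ≈ ε ⊎ S.member s
      ; rep-resp = λ s≈t → Sum.map (trans (sym s≈t)) (S.resp s≈t)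
      ; rep-⁻¹   = Sum.map (λ s≈ε → trans (⁻¹-cong s≈ε) ε⁻¹≈ε) S.⁻¹∈
      ; distinct = λ {s} {t} s∈T t∈T s∼t →
          -- Both `ε` and `t ∙ s ⁻¹` are code vertices within distance 1 of `s ⁻¹`, so they
          -- coincide.
          let (y , _ , unique) = perfect (s ⁻¹)
              y≈ε = unique (H.ε∈ , near s∈T (solve 1 (λ s → e ⊕ ⊖ ⊖ s ⊜ s) refl s))
              y≈ts⁻¹ = unique (s∼t , near t∈T (solve 2 (λ s t → t ⊕ ⊖ s ⊕ ⊖ ⊖ s ⊜ t) refl s t))
          in sym (x∙y⁻¹≈ε⇒x≈y t s (trans (sym y≈ts⁻¹) y≈ε))
      }

    complete : Complete T
    complete x with perfect (x ⁻¹)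
    ... | y , (y∈H , d) , _ = y ∙ x ⁻¹ ⁻¹ , far d ,
      H.resp (solve 2 (λ x y → y ⊜ y ⊕ ⊖ ⊖ x ⊕ ⊖ x) refl x y) y∈H

  -- Take S = T ∖ H, which makes `H` independent. A vertex `x` outside `H` is joined to `H` exactly
  -- by the representative of `Hx⁻¹`, which is itself outside `H`.
  transversal⇒perfect-code : ∃ Complete → IsPerfectCodeOf G H
  transversal⇒perfect-code (T , complete) = S , record { independent = independent ; perfect = perfect }
    where
    S : ConnectionSet G
    S = record
      { member = λ s → rep T s × ¬ member H s
      ; resp   = λ s≈t (s∈T , s∉H) → rep-resp T s≈t s∈T , λ t∈H → s∉H (H.resp (sym s≈t) t∈H)
      ; ε∉     = λ (_ , ε∉H) → ε∉H H.ε∈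
      ; ⁻¹∈    = λ (s∈T , s∉H) → rep-⁻¹ T s∈T , λ s⁻¹∈H → s∉H (H.resp (⁻¹-involutive _) (H.⁻¹∈ s⁻¹∈H))
      }
    Γ = Cay G S
    independent : ∀ {x y} → member H x → member H y → ¬ Graph.Adj Γ x y
    independent x∈H y∈H (_ , yx⁻¹∉H) = yx⁻¹∉H (H.∙∈ y∈H (H.⁻¹∈ x∈H))
    Near : Carrier → Pred Carrier (c ⊔ ℓ)
    Near x y = member H y × DistanceAtMost Γ 1 x y
    perfect : ∀ x → ∃ λ y → Near x y × (∀ {z} → Near x z → y ≈ z)
    perfect x with H? x
    ... | yes x∈H = x , (x∈H , 0 , z≤n , nil refl) , unique
      where
      unique : ∀ {z} → Near x z → x ≈ z
      unique (_ , _ , _ , nil x≈z) = x≈z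
      unique (z∈H , _ , _ , step xy (nil y≈z)) =
        contradiction xy (independent x∈H (H.resp (sym y≈z) z∈H))
      unique (_ , _ , s≤s () , step _ (step _ _))
    ... | no x∉H with complete (x ⁻¹)
    ...   | t , t∈T , x⁻¹∼t = t ∙ x , (tx∈H , 1 , s≤s z≤n , step adjacent (nil refl)) , unique
      where
      tx∈H : member H (t ∙ x)
      tx∈H = H.resp (∙-congˡ (⁻¹-involutive x)) x⁻¹∼t
      adjacent : Graph.Adj Γ x (t ∙ x)
      adjacent = ConnectionSet.resp S (solve 2 (λ t x → t ⊜ t ⊕ x ⊕ ⊖ x) refl t x)
        (t∈T , λ t∈H → x∉H (H.resp (solve 2 (λ t x → ⊖ t ⊕ (t ⊕ x) ⊜ x) refl t x)
                             (H.∙∈ (H.⁻¹∈ t∈H) tx∈H)))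
      unique : ∀ {z} → Near x z → t ∙ x ≈ z
      unique (z∈H , _ , _ , nil x≈z) = contradiction (H.resp (sym x≈z) z∈H) x∉H
      unique {z} (z∈H , _ , _ , step {y = y} (s∈T , _) (nil y≈z)) = trans
        (∙-congʳ (distinct T t∈T s∈T
          (H.resp (solve 3 (λ t x y → y ⊕ ⊖ (t ⊕ x) ⊜ y ⊕ ⊖ x ⊕ ⊖ t) refl t x y)
            (H.∙∈ (H.resp (sym y≈z) z∈H) (H.⁻¹∈ tx∈H)))))
        (trans (solve 2 (λ x y → y ⊕ ⊖ x ⊕ x ⊜ y) refl x y) y≈z)
      unique (_ , _ , s≤s () , step _ (step _ _))

-- The lift `g` lies in `Qx`, hence in `L` as soon as `Q ⊆ L`. As in `Ω₁`, the identity counts as an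
-- involution.
LiftsInvolutions : ∀ {c ℓ} (G : Group c ℓ) → Subgroup G → Subgroup G → Set (c ⊔ ℓ)
LiftsInvolutions G Q L = ∀ x → member L x → member Q (x ∙ x) →
                         ∃ λ g → g ∙ g ≈ ε × member Q (g ∙ x ⁻¹)
  where open Group G

-- 2-subgroups, their normalizers and lifted involutions

module _ {c ℓ} (G : Group c ℓ) {n} (order : HasOrder G n) where
  open Group G
  open GroupProperties G
  open FreeGroupSolver G using (solve; _⊜_; _⊕_; ⊖_; e)
  open CosetCounting G order

  module TwoSubgroup (Q : Subgroup G) (Q? : Decidable (member Q)) {k} (#Q∣2^k : # Q? ∣ 2 ^ k) where
    private module Q = Subgroup Q
    open Mod Q
    open DoubleCosets Q Q Q? Q? using (conjugate-∈?; ∣#-without-conjugates)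

    -- The inclusion of `g⁻¹Qg` in `Q` is an equality by finiteness: otherwise `gQg⁻¹` would contain
    -- `Q` only in part, making `g⁻¹Qg` a proper subset of `Q` of the same size.
    conjugates⇒normalizes : ∀ {g} → (∀ q → member Q q → member Q (g ⁻¹ ∙ q ∙ g)) →
                            member (normalizer Q) g
    conjugates⇒normalizes {g} conj x = mk⇔ into out
      where
      out : ∀ {x} → member Q (g ∙ x ∙ g ⁻¹) → member Q x
      out {x} gxg⁻¹∈Q =
        Q.resp (solve 2 (λ g x → ⊖ g ⊕ (g ⊕ x ⊕ ⊖ g) ⊕ g ⊜ x) refl g x) (conj _ gxg⁻¹∈Q)
      conj? = λ x → Q? (g ∙ x ∙ g ⁻¹)
      into : member Q x → member Q (g ∙ x ∙ g ⁻¹)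
      into x∈Q with conj? x
      ... | yes gxg⁻¹∈Q = gxg⁻¹∈Q
      ... | no gxg⁻¹∉Q = contradiction
        (#-bijection Q? Q.resp (λ x → g ∙ x ∙ g ⁻¹) (λ x → g ⁻¹ ∙ x ∙ g)
          (∙-congʳ ∘ ∙-congˡ) (∙-congʳ ∘ ∙-congˡ)
          (λ x → solve 2 (λ g x → g ⊕ (⊖ g ⊕ x ⊕ g) ⊕ ⊖ g ⊜ x) refl g x)
          (λ x → solve 2 (λ g x → ⊖ g ⊕ (g ⊕ x ⊕ ⊖ g) ⊕ g ⊜ x) refl g x))
        (ℕ.<⇒≢ (#-strict conj? Q? (Q.resp ∘ ∙-congʳ ∘ ∙-congˡ) Q.resp out x∈Q gxg⁻¹∉Q))

    normalizes⇒conjugates : ∀ {g} → member (normalizer Q) g →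
                            ∀ q → member Q q → member Q (g ⁻¹ ∙ q ∙ g)
    normalizes⇒conjugates {g} g∈N q q∈Q = Equivalence.from (g∈N _)
      (Q.resp (solve 2 (λ g q → q ⊜ g ⊕ (⊖ g ⊕ q ⊕ g) ⊕ ⊖ g) refl g q) q∈Q)

    subgroup⊆normalizer : ∀ {q} → member Q q → member (normalizer Q) q
    subgroup⊆normalizer q∈Q = conjugates⇒normalizes λ r r∈Q → Q.∙∈ (Q.∙∈ (Q.⁻¹∈ q∈Q) r∈Q) q∈Q

    -- Outside N(Q) the double cosets QyQ have even index over Q, and on the
    -- cosets of Q in A ∩ N(Q) inversion acts.
    square-in-or-even : {A : Pred Carrier (c ⊔ ℓ)} (A? : Decidable A) → A Respects _≈_ →
      (∀ {x} → A x → A (x ⁻¹)) →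
      (∀ {q x} → member Q q → A x → A (q ∙ x)) →
      (∀ {q x} → member Q q → A x → A (x ∙ q)) →
      (∃ λ x → A x × member (normalizer Q) x × member Q (x ∙ x)) ⊎ 2 * # Q? ∣ # A?
    square-in-or-even {A} A? resp A⁻¹ QA AQ
      with any? square-resp (λ x → A? x ×-dec conjugate-∈? x ×-dec Q? (x ∙ x))
      where
      square-resp : (λ x → A x × (∀ q → member Q q → member Q (x ⁻¹ ∙ q ∙ x)) × member Q (x ∙ x))
                    Respects _≈_
      square-resp x≈y (a , conj , xx∈Q) =
        resp x≈y a ,
        (λ q q∈Q → Q.resp (∙-cong (∙-congʳ (⁻¹-cong x≈y)) x≈y) (conj q q∈Q)) ,
        Q.resp (∙-cong x≈y x≈y) xx∈Q
    ... | yes (x , a , conj , xx∈Q) = inj₁ (x , a , conjugates⇒normalizes conj , xx∈Q)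
    ... | no none = inj₂ (≡.subst (2 * # Q? ∣_) (≡.sym (#-split A? conjugate-∈?)) (∣m∣n⇒∣m+n inside outside))
      where
      N = normalizer Q
      module N = Subgroup N
      inside : 2 * # Q? ∣ # (A? ∩? conjugate-∈?)
      inside = ∣#-free-involution Q Q? (A? ∩? conjugate-∈?)
        (λ x≈y (a , conj) → resp x≈y a , normalizes⇒conjugates (N.resp x≈y (conjugates⇒normalizes conj)))
        (λ {x} {y} x∼y (a , conj) →
          resp (solve 2 (λ x y → y ⊕ ⊖ x ⊕ x ⊜ y) refl x y) (QA x∼y a) ,
          normalizes⇒conjugates (N.resp (solve 2 (λ x y → y ⊕ ⊖ x ⊕ x ⊜ y) refl x y)
            (N.∙∈ (subgroup⊆normalizer x∼y) (conjugates⇒normalizes conj))))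
        _⁻¹
        (λ (a , conj) → A⁻¹ a , normalizes⇒conjugates (N.⁻¹∈ (conjugates⇒normalizes conj)))
        -- Inversion turns right cosets of `Q` into left cosets; these agree because `x` normalizes
        -- `Q`.
        (λ {x} {y} (a , conj) x∼y →
          Q.resp (solve 2 (λ x y → ⊖ x ⊕ ⊖ (y ⊕ ⊖ x) ⊕ x ⊜ ⊖ y ⊕ ⊖ ⊖ x) refl x y) (conj _ (Q.⁻¹∈ x∼y)))
        (λ _ → ∼-reflexive (⁻¹-involutive _))
        (λ {x} (a , conj) x⁻¹∼x → none (x , a , conj , Q.resp (∙-congˡ (⁻¹-involutive x)) x⁻¹∼x))
      outside : 2 * # Q? ∣ # (A? ∩? ∁? conjugate-∈?)
      outside = ∣#-without-conjugates {k} #Q∣2^k (A? ∩? ∁? conjugate-∈?)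
        (λ x≈y (a , ¬conj) → resp x≈y a , λ conj → ¬conj (normalizes⇒conjugates
          (N.resp (sym x≈y) (conjugates⇒normalizes conj))))
        (λ {r} {x} r∈Q (a , ¬conj) → QA r∈Q a , λ conj → ¬conj (normalizes⇒conjugates
          (N.resp (solve 2 (λ r x → ⊖ r ⊕ (r ⊕ x) ⊜ x) refl r x)
            (N.∙∈ (N.⁻¹∈ (subgroup⊆normalizer r∈Q)) (conjugates⇒normalizes conj)))))
        (λ {r} {x} r∈Q (a , ¬conj) → AQ r∈Q a , λ conj → ¬conj (normalizes⇒conjugates
          (N.resp (solve 2 (λ r x → x ⊕ r ⊕ ⊖ r ⊜ x) refl r x)
            (N.∙∈ (conjugates⇒normalizes conj) (N.⁻¹∈ (subgroup⊆normalizer r∈Q))))))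
        proj₂

  -- Perfect codes and lifted involutions when `Q` has odd index in `H`

  module OddIndex (Q H : Subgroup G) (Q? : Decidable (member Q)) (H? : Decidable (member H))
    (Q⊆H : ∀ {x} → member Q x → member H x) (odd-index : ¬ 2 * # Q? ∣ # H?) where
    private
      module Q = Subgroup Q
      module H = Subgroup H
      module Q~ = Mod Q
      module H~ = Mod H
    open Transversals G order H H?
    open PartialTransversal

    transversal⇒lifts-involutions : ∃ Complete → LiftsInvolutions G Q (normalizer Q)
    transversal⇒lifts-involutions (T , complete) x x∈N xx∈Q =
      lift (decidable-stable fixed? λ none → odd-index (∣#-free-involution Q Q? H? H.resp
        (λ h∼h′ h∈H → H~.∼⇒∈ (Q⊆H h∼h′) h∈H) ι
        (λ {h} → ι∈H h) (λ _ → ι-cong) (λ {h} h∈H → ι-involutive h∈H)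
        (λ {h} h∈H fixed → none (h , h∈H , fixed))))
      where
      τ : Carrier → Carrier
      τ y = proj₁ (complete y)

      τ∈T : ∀ y → rep T (τ y)
      τ∈T y = proj₁ (proj₂ (complete y))

      ∼τ : ∀ y → H ⊢ y ∼ τ y
      ∼τ y = proj₂ (proj₂ (complete y))

      τ-unique : ∀ {y t} → rep T t → H ⊢ y ∼ t → τ y ≈ t
      τ-unique {y} t∈T y∼t = distinct T (τ∈T y) t∈T (H~.∼-trans (H~.∼-sym (∼τ y)) y∼t)

      -- If t represents the coset Hxh, then t⁻¹ represents the coset Hx(ι h).
      ι : Carrier → Carrier
      ι h = x ⁻¹ ∙ h ∙ τ (x ∙ h) ⁻¹

      conj : ∀ {q} → member Q q → member Q (x ∙ q ∙ x ⁻¹)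
      conj {q} = Equivalence.to (x∈N q)

      conj⁻¹ : ∀ {q} → member Q q → member Q (x ⁻¹ ∙ q ∙ x)
      conj⁻¹ {q} q∈Q = Equivalence.from (x∈N _)
        (Q.resp (solve 2 (λ x q → q ⊜ x ⊕ (⊖ x ⊕ q ⊕ x) ⊕ ⊖ x) refl x q) q∈Q)

      -- With t = `τ (x ∙ h)`, `ι h` is x⁻² times xht⁻¹, and both factors lie in `H`.
      ι∈H : ∀ h → member H h → member H (ι h)
      ι∈H h _ = H.resp
        (solve 3 (λ x h t → ⊖ (x ⊕ x) ⊕ ⊖ (t ⊕ ⊖ (x ⊕ h)) ⊜ ⊖ x ⊕ h ⊕ ⊖ t) refl x h (τ (x ∙ h)))
        (H.∙∈ (H.⁻¹∈ (Q⊆H xx∈Q)) (H.⁻¹∈ (∼τ (x ∙ h))))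

      τ-cong : ∀ {h h′} → Q ⊢ h ∼ h′ → τ (x ∙ h) ≈ τ (x ∙ h′)
      τ-cong {h} {h′} h∼h′ = τ-unique (τ∈T _) (H~.∼-trans
        (Q⊆H (Q.resp (solve 3 (λ x h h′ → x ⊕ (h′ ⊕ ⊖ h) ⊕ ⊖ x ⊜ x ⊕ h′ ⊕ ⊖ (x ⊕ h)) refl x h h′)
          (conj h∼h′)))
        (∼τ _))

      ι-cong : ∀ {h h′} → Q ⊢ h ∼ h′ → Q ⊢ ι h ∼ ι h′
      ι-cong {h} {h′} h∼h′ = Q.resp
        (trans (solve 4 (λ x h h′ t → ⊖ x ⊕ (h′ ⊕ ⊖ h) ⊕ x ⊜ ⊖ x ⊕ h′ ⊕ ⊖ t ⊕ ⊖ (⊖ x ⊕ h ⊕ ⊖ t))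
                  refl x h h′ (τ (x ∙ h)))
               (∙-congʳ (∙-congˡ (⁻¹-cong (τ-cong h∼h′)))))
        (conj⁻¹ h∼h′)

      -- The second application contributes the representative t⁻¹, which cancels the first and
      -- leaves x⁻²h.
      ι-involutive : ∀ {h} → member H h → Q ⊢ ι (ι h) ∼ h
      ι-involutive {h} h∈H = Q.resp
        (trans (solve 3 (λ x h t → x ⊕ x ⊜ h ⊕ ⊖ (⊖ x ⊕ (⊖ x ⊕ h ⊕ ⊖ t) ⊕ ⊖ ⊖ t)) refl x h t)
               (∙-congˡ (⁻¹-cong (∙-congˡ (⁻¹-cong (sym τ≈t⁻¹))))))
        xx∈Q
        where
        t = τ (x ∙ h)
        τ≈t⁻¹ : τ (x ∙ ι h) ≈ t ⁻¹
        τ≈t⁻¹ = τ-unique (rep-⁻¹ T (τ∈T _)) (H.resp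
          (solve 3 (λ x h t → ⊖ h ⊜ ⊖ t ⊕ ⊖ (x ⊕ (⊖ x ⊕ h ⊕ ⊖ t))) refl x h t) (H.⁻¹∈ h∈H))

      Fixed : Pred Carrier (c ⊔ ℓ)
      Fixed h = member H h × Q ⊢ ι h ∼ h

      fixed? : Dec (∃ Fixed)
      fixed? = any? {A = Fixed}
        (λ h≈h′ (h∈H , ιh∼h) → H.resp h≈h′ h∈H ,
          Q~.∼-trans (Q~.∼-sym (ι-cong (Q~.∼-reflexive h≈h′))) (Q~.∼-resp h≈h′ ιh∼h))
        (λ h → H? h ×-dec Q? (h ∙ ι h ⁻¹))

      lift : ∃ Fixed → ∃ λ g → g ∙ g ≈ ε × member Q (g ∙ x ⁻¹)
      lift (h , h∈H , ιh∼h) = g , gg≈ε , Q.resp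
          (solve 2 (λ x g → g ⊕ x ⊕ ⊖ (x ⊕ x) ⊜ g ⊕ ⊖ x) refl x g) (Q.∙∈ gx∈Q (Q.⁻¹∈ xx∈Q))
        where
        t = τ (x ∙ h)
        g = h ∙ t ∙ h ⁻¹
        gx∈Q : member Q (g ∙ x)
        gx∈Q = Q.resp (solve 3 (λ x h t → h ⊕ ⊖ (⊖ x ⊕ h ⊕ ⊖ t) ⊜ h ⊕ t ⊕ ⊖ h ⊕ x) refl x h t) ιh∼h
        -- With q = gx in `Q`, g⁻² = (xq⁻¹x⁻¹)x²q⁻¹ lies in `Q`, so t⁻² = h⁻¹g⁻²h lies in `H`. Thus
        -- `t` and its inverse represent one coset and must be equal.
        t∼t⁻¹ : H ⊢ t ∼ (t ⁻¹)
        t∼t⁻¹ = H.resp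
          (solve 3 (λ x h t → let q = h ⊕ t ⊕ ⊖ h ⊕ x in
             ⊖ h ⊕ (x ⊕ ⊖ q ⊕ ⊖ x ⊕ (x ⊕ x) ⊕ ⊖ q) ⊕ h ⊜ ⊖ t ⊕ ⊖ t) refl x h t)
          (H.∙∈ (H.∙∈ (H.⁻¹∈ h∈H)
            (Q⊆H (Q.∙∈ (Q.∙∈ (conj (Q.⁻¹∈ gx∈Q)) xx∈Q) (Q.⁻¹∈ gx∈Q)))) h∈H)
        gg≈ε : g ∙ g ≈ ε
        gg≈ε = trans (solve 2 (λ h t → h ⊕ t ⊕ ⊖ h ⊕ (h ⊕ t ⊕ ⊖ h) ⊜ h ⊕ (t ⊕ t) ⊕ ⊖ h) refl h t)
          (trans (∙-congʳ (∙-congˡ (self-inverse (distinct T (τ∈T _) (rep-⁻¹ T (τ∈T _)) t∼t⁻¹))))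
                 (solve 1 (λ h → h ⊕ e ⊕ ⊖ h ⊜ e) refl h))

    -- Greedy construction of an inverse-closed transversal

    module Construction {k} (#Q∣2^k : # Q? ∣ 2 ^ k) (lifts : LiftsInvolutions G Q (normalizer Q)) where
      open TwoSubgroup Q Q? {k} #Q∣2^k using (square-in-or-even)
      open DoubleCosets H H H? H? using () renaming
        (RgK to HxH; RgK? to HxH?; RgK-resp to HxH-resp; RgK-refl to HxH-refl; RgK-intro to HxH-intro)

      HxHˡ : ∀ {x h y} → member H h → HxH x y → HxH x (h ∙ y)
      HxHˡ {x} {h} {y} h∈H (r , r∈H , k∈H) = HxH-resp
        (solve 4 (λ x h y r → h ⊕ r ⊕ x ⊕ (⊖ (r ⊕ x) ⊕ y) ⊜ h ⊕ y) refl x h y r)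
        (HxH-intro x (H.∙∈ h∈H r∈H) k∈H)

      HxHʳ : ∀ {x h y} → member H h → HxH x y → HxH x (y ∙ h)
      HxHʳ {x} {h} {y} h∈H (r , r∈H , k∈H) = HxH-resp
        (solve 4 (λ x h y r → r ⊕ x ⊕ (⊖ (r ⊕ x) ⊕ y ⊕ h) ⊜ y ⊕ h) refl x h y r)
        (HxH-intro x r∈H (H.∙∈ k∈H h∈H))

      HxH-∼ : ∀ {x y z} → H ⊢ y ∼ z → HxH x y → HxH x z
      HxH-∼ {x} {y} {z} y∼z y∈D = HxH-resp (solve 2 (λ y z → z ⊕ ⊖ y ⊕ y ⊜ z) refl y z) (HxHˡ y∼z y∈D)

      module Extension (T : PartialTransversal) (rep? : Decidable (rep T)) {x} (uncovered : ¬ Covered T x) where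
        private
          Cov? = covered? T rep?

        τ : Carrier → Carrier
        τ y with Cov? y
        ... | yes (t , _) = t
        -- An arbitrary value: properties of `τ` are drawn only from `τ-correct`, on covered cosets.
        ... | no _ = ε

        τ-correct : ∀ {y} → Covered T y → rep T (τ y) × H ⊢ y ∼ τ y
        τ-correct {y} cov with Cov? y
        ... | yes (t , t∈T , y∼t) = t∈T , y∼t
        ... | no ¬cov = contradiction cov ¬cov

        -- These conditions let `t` and its inverse join `T` together: both cosets are free, and if
        -- they are the same coset it receives a single element.
        Admissible : Pred Carrier (c ⊔ ℓ)
        Admissible t = H ⊢ x ∼ t × ¬ Covered T (t ⁻¹) × (H ⊢ t ∼ (t ⁻¹) → t ≈ t ⁻¹)

        admissible? : Dec (∃ Admissible)
        admissible? = any?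
          (λ {s} {t} s≈t (x∼s , ¬cov , p) →
             H~.∼-resp s≈t x∼s , ¬cov ∘ Covered-resp T (⁻¹-cong (sym s≈t)) ,
             λ t∼t⁻¹ → trans (sym s≈t) (trans
               (p (H.resp (∙-cong (⁻¹-cong (sym s≈t)) (⁻¹-cong (sym s≈t))) t∼t⁻¹))
               (⁻¹-cong s≈t)))
          (λ t → H? (t ∙ x ⁻¹) ×-dec ¬? (Cov? (t ⁻¹)) ×-dec (H? (t ⁻¹ ∙ t ⁻¹) →-dec (t ≟ t ⁻¹)))

        module Stuck (none : ¬ ∃ Admissible) where
          -- If g = rxk squares to `ε`, so does its conjugate kgk⁻¹ = krx, which lies in `Hx` and
          -- would be admissible.
          no-involution : ∀ {g} → HxH x g → ¬ g ∙ g ≈ ε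
          no-involution {g} (r , r∈H , k∈H) gg≈ε = none (t , x∼t ,
            uncovered ∘ Covered-∼ T (H~.∼-trans (H~.∼-reflexive (sym t≈t⁻¹)) (H~.∼-sym x∼t)) ,
            λ _ → t≈t⁻¹)
            where
            k′ = (r ∙ x) ⁻¹ ∙ g
            t = k′ ∙ g ∙ k′ ⁻¹
            x∼t : H ⊢ x ∼ t
            x∼t = H.resp (solve 3 (λ x r g → let k = ⊖ (r ⊕ x) ⊕ g in
              k ⊕ r ⊜ k ⊕ g ⊕ ⊖ k ⊕ ⊖ x) refl x r g) (H.∙∈ k∈H r∈H)
            t≈t⁻¹ : t ≈ t ⁻¹
            t≈t⁻¹ = trans (∙-congʳ (∙-congˡ (inverseˡ-unique g g gg≈ε)))
              (solve 2 (λ k g → k ⊕ ⊖ g ⊕ ⊖ k ⊜ ⊖ (k ⊕ g ⊕ ⊖ k)) refl k′ g)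

          -- Write y⁻¹ = rxk. Then t = rx lies in `Hx` and t⁻¹ = ky in the uncovered coset `Hy`; if
          -- these cosets differed, `t` would be admissible.
          uncovered-inverse : ∀ {y} → HxH x (y ⁻¹) → ¬ Covered T y → H ⊢ x ∼ y
          uncovered-inverse {y} (r , r∈H , k∈H) ¬cov = H~.∼-trans x∼t (H~.∼-trans t∼t⁻¹ (H~.∼-sym y∼t⁻¹))
            where
            t = r ∙ x
            x∼t : H ⊢ x ∼ t
            x∼t = H~.∙-∼ x r∈H
            y∼t⁻¹ : H ⊢ y ∼ (t ⁻¹)
            y∼t⁻¹ = k∈H
            t∼t⁻¹ : H ⊢ t ∼ (t ⁻¹)
            t∼t⁻¹ = decidable-stable (H? _) λ t≁t⁻¹ →
              none (t , x∼t , ¬cov ∘ Covered-∼ T (H~.∼-sym y∼t⁻¹) , λ t∼t⁻¹ → contradiction t∼t⁻¹ t≁t⁻¹)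

          Inverse-uncovered : Pred Carrier (c ⊔ ℓ)
          Inverse-uncovered y = HxH x (y ⁻¹) × ¬ Covered T y

          -- If all of D⁻¹ were covered, for D = HxH, inverting representatives would inject D into
          -- its covered part, which misses `x`.
          some-inverse-uncovered : ∃ Inverse-uncovered
          some-inverse-uncovered = decidable-stable
            (any? {A = Inverse-uncovered}
              (λ y≈z (y⁻¹∈D , ¬cov) → HxH-resp (⁻¹-cong y≈z) y⁻¹∈D , ¬cov ∘ Covered-resp T (sym y≈z))
              (λ y → HxH? x (y ⁻¹) ×-dec ¬? (Cov? y)))
            λ all-covered → ℕ.<-irrefl ≡.refl (ℕ.<-≤-trans
              (#-strict covered-part? (HxH? x)
                (λ y≈z (y∈D , cov) → HxH-resp y≈z y∈D , Covered-resp T y≈z cov)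
                HxH-resp proj₁ HxH-refl (uncovered ∘ proj₂))
              (#-injection (HxH? x) covered-part?
                (λ y≈z (y∈D , cov) → HxH-resp y≈z y∈D , Covered-resp T y≈z cov)
                f (maps all-covered) (injective all-covered)))
            where
            covered-part? = HxH? x ∩? Cov?
            -- A representative s of Hy⁻¹ yields the representative s⁻¹ of a coset in D = HxH;
            -- f maps y into the latter coset.
            f : Carrier → Carrier
            f y = y ⁻¹ ∙ τ (y ⁻¹) ⁻¹ ∙ τ (y ⁻¹) ⁻¹
            module _ (all-covered : ¬ ∃ Inverse-uncovered) {y} (y∈D : HxH x y) where
              s = τ (y ⁻¹)
              τ-inverse : rep T s × H ⊢ (y ⁻¹) ∼ s
              τ-inverse = τ-correct (decidable-stable (Cov? (y ⁻¹)) λ ¬cov →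
                all-covered (y ⁻¹ , HxH-resp (sym (⁻¹-involutive y)) y∈D , ¬cov))
              f∼s⁻¹ : H ⊢ f y ∼ (s ⁻¹)
              f∼s⁻¹ = H.resp (solve 2 (λ y s → s ⊕ ⊖ ⊖ y ⊜ ⊖ s ⊕ ⊖ (⊖ y ⊕ ⊖ s ⊕ ⊖ s)) refl y s) (proj₂ τ-inverse)
              maps : HxH x (f y) × Covered T (f y)
              maps = HxH-∼ (H~.∼-sym f∼s⁻¹)
                  (HxH-resp (solve 2 (λ y s → y ⊕ ⊖ (s ⊕ ⊖ ⊖ y) ⊜ ⊖ s) refl y s)
                    (HxHʳ (H.⁻¹∈ (proj₂ τ-inverse)) y∈D)) ,
                s ⁻¹ , rep-⁻¹ T (proj₁ τ-inverse) , f∼s⁻¹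
            injective : ¬ ∃ Inverse-uncovered → ∀ {y z} → HxH x y → HxH x z → f y ≈ f z → y ≈ z
            injective all-covered {y} {z} y∈D z∈D fy≈fz = ⁻¹-injective
              (∙-cancelʳ _ _ _ (∙-cancelʳ _ _ _ (trans fy≈fz (∙-cong (∙-congˡ (sym s⁻¹≈)) (sym s⁻¹≈)))))
              where
              s⁻¹≈ : τ (y ⁻¹) ⁻¹ ≈ τ (z ⁻¹) ⁻¹
              s⁻¹≈ = distinct T
                (rep-⁻¹ T (proj₁ (τ-inverse all-covered y∈D)))
                (rep-⁻¹ T (proj₁ (τ-inverse all-covered z∈D)))
                (H~.∼-trans (H~.∼-sym (f∼s⁻¹ all-covered y∈D))
                  (H~.∼-trans (H~.∼-reflexive fy≈fz) (f∼s⁻¹ all-covered z∈D)))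

          -- D = HxH is self-inverse and Hx is its only uncovered right coset; inverting
          -- representatives pairs up the others, so |D| ≡ |H| modulo 2|H|.
          index-even : 2 * # Q? ∣ # H?
          index-even with y , y⁻¹∈D , ¬cov ← some-inverse-uncovered
            with x∼y ← uncovered-inverse y⁻¹∈D ¬cov = 2#Q∣#H
            where
            coset? = λ z → H? (z ∙ x ⁻¹)
            D? = HxH? x
            -- From `y ⁻¹` in D and Hy = Hx; this is what makes D closed under inversion.
            x⁻¹∈D : HxH x (x ⁻¹)
            x⁻¹∈D = HxH-resp (solve 2 (λ x y → ⊖ y ⊕ (y ⊕ ⊖ x) ⊜ ⊖ x) refl x y) (HxHʳ x∼y y⁻¹∈D)
            D⁻¹ : ∀ {z} → HxH x z → HxH x (z ⁻¹)
            D⁻¹ {z} (r , r∈H , k∈H) = HxH-resp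
              (solve 3 (λ x r z → ⊖ (⊖ (r ⊕ x) ⊕ z) ⊕ ⊖ x ⊕ ⊖ r ⊜ ⊖ z) refl x r z)
              (HxHʳ (H.⁻¹∈ r∈H) (HxHˡ (H.⁻¹∈ k∈H) x⁻¹∈D))
            rest? = D? ∩? ∁? coset?
            covered : ∀ {z} → HxH x z × ¬ H ⊢ x ∼ z → rep T (τ z) × H ⊢ z ∼ τ z
            covered {z} (z∈D , x≁z) = τ-correct (decidable-stable (Cov? z)
              (x≁z ∘ uncovered-inverse (D⁻¹ z∈D)))
            ι : Carrier → Carrier
            ι z = τ z ⁻¹
            ι∈rest : ∀ {z} → HxH x z × ¬ H ⊢ x ∼ z → HxH x (ι z) × ¬ H ⊢ x ∼ ι z
            ι∈rest z∈rest@(z∈D , _) with covered z∈rest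
            ... | τ∈T , z∼τ = D⁻¹ (HxH-∼ z∼τ z∈D) ,
              λ x∼ι → uncovered (_ , rep-⁻¹ T τ∈T , x∼ι)
            rest-∼ : ∀ {y z} → H ⊢ y ∼ z → HxH x y × ¬ H ⊢ x ∼ y → HxH x z × ¬ H ⊢ x ∼ z
            rest-∼ y∼z (y∈D , x≁y) = HxH-∼ y∼z y∈D , λ x∼z → x≁y (H~.∼-trans x∼z (H~.∼-sym y∼z))
            rest-even : 2 * # H? ∣ # rest?
            rest-even = ∣#-free-involution H H? rest?
              (rest-∼ ∘ H~.∼-reflexive) rest-∼ ι ι∈rest
              (λ y∈rest y∼z → let (s∈T , y∼s) = covered y∈rest
                                  (t∈T , z∼t) = covered (rest-∼ y∼z y∈rest)
                in H~.∼-reflexive (⁻¹-cong (distinct T s∈T t∈T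
                     (H~.∼-trans (H~.∼-sym y∼s) (H~.∼-trans y∼z z∼t)))))
              (λ z∈rest → let (s∈T , z∼s) = covered z∈rest
                              (t∈T , ιz∼t) = covered (ι∈rest z∈rest)
                in H~.∼-trans (H~.∼-reflexive (trans
                     (⁻¹-cong (sym (distinct T (rep-⁻¹ T s∈T) t∈T ιz∼t))) (⁻¹-involutive _)))
                     (H~.∼-sym z∼s))
              -- On a fixed coset `τ z` would equal its own inverse and be an element of D with
              -- square `ε`.
              (λ z∈rest@(z∈D , _) ιz∼z → let (s∈T , z∼s) = covered z∈rest
                in no-involution (HxH-∼ z∼s z∈D) (self-inverse (sym
                     (distinct T (rep-⁻¹ T s∈T) s∈T (H~.∼-trans ιz∼z z∼s)))))
            D-even : 2 * # Q? ∣ # D?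
            D-even with square-in-or-even D? HxH-resp D⁻¹ (HxHˡ ∘ Q⊆H) (HxHʳ ∘ Q⊆H)
            ... | inj₂ even = even
            ... | inj₁ (z , z∈D , z∈N , zz∈Q) with g , gg≈ε , gz⁻¹∈Q ← lifts z z∈N zz∈Q =
              contradiction gg≈ε (no-involution (HxH-∼ (Q⊆H gz⁻¹∈Q) z∈D))
            -- D splits into `Hx`, of size |H|, and the rest. As |Q| divides |H|, 2|Q| divides the
            -- size of the rest as well as |D|, hence |H|.
            2#Q∣#H : 2 * # Q? ∣ # H?
            2#Q∣#H = ≡.subst (2 * # Q? ∣_)
              (≡.trans
                (#-cong (D? ∩? coset?) coset? proj₂ (λ x∼z → HxH-∼ x∼z HxH-refl , x∼z))
                (#-coset H H? x))
              (∣m+n∣m⇒∣n (≡.subst (2 * # Q? ∣_) (≡.trans (#-split D? coset?) (ℕ.+-comm _ (# rest?))) D-even)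
                (∣-trans (*-monoʳ-∣ 2 (lagrange {Q} {H} Q? H? Q⊆H)) rest-even))

        admissible : ∃ Admissible
        admissible = decidable-stable admissible? (odd-index ∘ Stuck.index-even)

        t₀ : Carrier
        t₀ = proj₁ admissible

        extension : PartialTransversal
        extension = record
          { rep      = λ s → rep T s ⊎ s ≈ t₀ ⊎ s ≈ t₀ ⁻¹
          ; rep-resp = λ s≈t → Sum.map (rep-resp T s≈t) (Sum.map (trans (sym s≈t)) (trans (sym s≈t)))
          ; rep-⁻¹   = Sum.map (rep-⁻¹ T) (Sum.swap ∘
              Sum.map ⁻¹-cong (λ s≈t₀⁻¹ → trans (⁻¹-cong s≈t₀⁻¹) (⁻¹-involutive _)))
          ; distinct = λ where
              (inj₁ s∈T) (inj₁ t∈T) s∼t → distinct T s∈T t∈T s∼t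
              (inj₁ s∈T) (inj₂ t-new) s∼t → contradiction (_ , s∈T , H~.∼-sym s∼t) (new-uncovered t-new)
              (inj₂ s-new) (inj₁ t∈T) s∼t → contradiction (_ , t∈T , s∼t) (new-uncovered s-new)
              (inj₂ (inj₁ s≈t₀)) (inj₂ (inj₁ t≈t₀)) _ → trans s≈t₀ (sym t≈t₀)
              (inj₂ (inj₂ s≈t₀⁻¹)) (inj₂ (inj₂ t≈t₀⁻¹)) _ → trans s≈t₀⁻¹ (sym t≈t₀⁻¹)
              (inj₂ (inj₁ s≈t₀)) (inj₂ (inj₂ t≈t₀⁻¹)) s∼t →
                trans s≈t₀ (trans (t₀≈t₀⁻¹ s≈t₀ t≈t₀⁻¹ s∼t) (sym t≈t₀⁻¹))
              (inj₂ (inj₂ s≈t₀⁻¹)) (inj₂ (inj₁ t≈t₀)) s∼t →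
                trans s≈t₀⁻¹ (trans (sym (t₀≈t₀⁻¹ t≈t₀ s≈t₀⁻¹ (H~.∼-sym s∼t))) (sym t≈t₀))
          }
          where
          t₀≈t₀⁻¹ : ∀ {s t} → s ≈ t₀ → t ≈ t₀ ⁻¹ → H ⊢ s ∼ t → t₀ ≈ t₀ ⁻¹
          t₀≈t₀⁻¹ s≈t₀ t≈t₀⁻¹ s∼t = proj₂ (proj₂ (proj₂ admissible))
            (H.resp (∙-cong t≈t₀⁻¹ (⁻¹-cong s≈t₀)) s∼t)
          new-uncovered : ∀ {s} → s ≈ t₀ ⊎ s ≈ t₀ ⁻¹ → ¬ Covered T s
          new-uncovered (inj₁ s≈t₀) = uncovered ∘
            Covered-∼ T (H~.∼-trans (H~.∼-reflexive s≈t₀) (H~.∼-sym (proj₁ (proj₂ admissible))))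
          new-uncovered (inj₂ s≈t₀⁻¹) = proj₁ (proj₂ (proj₂ admissible)) ∘ Covered-resp T s≈t₀⁻¹

        extension? : Decidable (rep extension)
        extension? s = rep? s ⊎-dec (s ≟ t₀ ⊎-dec s ≟ t₀ ⁻¹)

        extension-covers : Covered extension x
        extension-covers = t₀ , inj₂ (inj₁ refl) , proj₁ (proj₂ admissible)

      -- The number `m` exceeds the count of uncovered elements, which drops with each extension
      -- because `x` becomes covered.
      complete-from : ∀ m (T : PartialTransversal) (rep? : Decidable (rep T)) →
                      # (∁? (covered? T rep?)) < m → ∃ Complete
      complete-from (suc m) T rep? (s≤s bound)
        with any? (λ x≈y ¬cov → ¬cov ∘ Covered-resp T (sym x≈y)) (∁? (covered? T rep?))
      ... | no none = T , λ x → decidable-stable (covered? T rep? x) λ ¬cov → none (x , ¬cov)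
      ... | yes (x , ¬cov) = complete-from m extension extension? (ℕ.<-≤-trans
        (#-strict (∁? (covered? extension extension?)) (∁? (covered? T rep?))
          (λ x≈y ¬cov → ¬cov ∘ Covered-resp extension (sym x≈y))
          (λ x≈y ¬cov → ¬cov ∘ Covered-resp T (sym x≈y))
          (λ ¬cov (t , t∈T , x∼t) → ¬cov (t , inj₁ t∈T , x∼t))
          ¬cov (λ ¬cov′ → ¬cov′ extension-covers)) bound)
        where open Extension T rep? ¬cov

      complete-transversal : ∃ Complete
      complete-transversal = complete-from _ empty (λ _ → no λ ()) (ℕ.n<1+n _)
        where
        empty : PartialTransversal
        empty = record { rep = λ _ → ⊥* ; rep-resp = λ _ () ; rep-⁻¹ = λ () ; distinct = λ () }

    perfect-code⇔lifts-involutions : ∀ {k} → # Q? ∣ 2 ^ k →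
      IsPerfectCodeOf G H ⇔ LiftsInvolutions G Q (normalizer Q)
    perfect-code⇔lifts-involutions {k} #Q∣2^k = mk⇔
      (transversal⇒lifts-involutions ∘ perfect-code⇒transversal)
      (transversal⇒perfect-code ∘ Construction.complete-transversal {k} #Q∣2^k)

-- Orders of subgroups and Sylow data

module SubgroupOrder {c ℓ} (G : Group c ℓ) {n} (order : HasOrder G n)
  (K : Subgroup G) {m} (orderK : HasOrder (toGroup K) m) where
  open Group G
  private
    module K = Subgroup K
    module CK = Counting (Group.setoid (toGroup K)) orderK
    module CG = Counting setoid order

  -- Searches the enumeration of `K` for an element equal to `x`.
  member? : Decidable (member K)
  member? x = Dec.map′ (λ ((y , y∈K) , y≈x) → K.resp y≈x y∈K) (λ x∈K → (x , x∈K) , refl)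
    (CK.any? (λ y≈z y≈x → trans (sym y≈z) y≈x) (λ (y , _) → y CG.≟ x))

  -- Equality matches each member in `G` with exactly one class of `toGroup K`, where membership
  -- proofs are ignored.
  #-member : CG.# member? ≡ m
  #-member = begin
    CG.# member?      ≡⟨ ℕ.*-identityʳ _ ⟨
    CG.# member? * 1  ≡⟨ ℕ.≤-antisym upper lower ⟩
    CK.# all? * 1     ≡⟨ ℕ.*-identityʳ _ ⟩
    CK.# all?         ≡⟨ ones m ⟩
    m                 ∎
    where
    open ≡.≡-Reasoning
    all? : Decidable {A = Group.Carrier (toGroup K)} (λ _ → ⊤)
    all? _ = yes tt
    ones : ∀ m → sum {m} (λ _ → 1) ≡ m
    ones zero    = ≡.refl
    ones (suc m) = ≡.cong suc (ones m)
    upper : CG.# member? * 1 ≤ CK.# all? * 1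
    upper = DoubleCounting.double-counting setoid order (Group.setoid (toGroup K)) orderK
      member? all? (λ x (y , _) → y CG.≟ x) _
      (λ {x} x∈K → CK.#-positive (λ (y , _) → y CG.≟ x) (λ y≈z y≈x → trans (sym y≈z) y≈x) {x , x∈K} refl)
      (λ {(y , _)} _ → CG.#-≤1 (y CG.≟_) λ y≈x y≈z → trans (sym y≈x) y≈z)
    lower : CK.# all? * 1 ≤ CG.# member? * 1
    lower = DoubleCounting.double-counting (Group.setoid (toGroup K)) orderK setoid order
      all? member? (λ (y , _) x → y CG.≟ x)
      (λ {(y , y∈K)} y≈x → K.resp y≈x y∈K)
      (λ {(y , _)} _ → CG.#-positive (y CG.≟_) (λ x≈z y≈x → trans y≈x x≈z) refl)
      (λ {x} _ → CK.#-≤1 (λ (y , _) → y CG.≟ x) λ y≈x z≈x → trans y≈x (sym z≈x))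

-- Sylow hypotheses give orders inside the larger subgroup, whereas the counting takes place in `G`.
order-↾⁻ : ∀ {c ℓ} {G : Group c ℓ} (K L : Subgroup G) → K ⊆ L → ∀ {m} →
           HasOrder (toGroup (K ↾ L)) m → HasOrder (toGroup K) m
order-↾⁻ K L K⊆L order = record
  { to        = λ i → proj₁ (proj₁ (to i)) , proj₂ (to i)
  ; from      = λ (x , x∈K) → from ((x , K⊆L x∈K) , x∈K)
  ; to-cong   = to-cong
  ; from-cong = from-cong
  ; inverse   = inverseˡ , inverseʳ
  }
  where open Inverse order

order-↾⁺ : ∀ {c ℓ} {G : Group c ℓ} (K L : Subgroup G) → K ⊆ L → ∀ {m} →
           HasOrder (toGroup K) m → HasOrder (toGroup (K ↾ L)) m
order-↾⁺ K L K⊆L order = record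
  { to        = λ i → (proj₁ (to i) , K⊆L (proj₂ (to i))) , proj₂ (to i)
  ; from      = λ ((x , _) , x∈K) → from (x , x∈K)
  ; to-cong   = to-cong
  ; from-cong = from-cong
  ; inverse   = inverseˡ , inverseʳ
  }
  where open Inverse order

2-part⇒odd-index : ∀ {a b k l} → k ≡ 2 ^ a → l ≡ 2 ^ a * b → ¬ 2 ∣ b → ¬ 2 * k ∣ l
2-part⇒odd-index {a} {b} ≡.refl ≡.refl 2∤b 2*2^a∣2^a*b =
  2∤b (*-cancelˡ-∣ (2 ^ a) {{ℕ.m^n≢0 2 a}} (≡.subst (_∣ 2 ^ a * b) (ℕ.*-comm 2 (2 ^ a)) 2*2^a∣2^a*b))

-- Only one inclusion carries information: the coset of an element with trivial square always has
-- trivial square.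
Ω₁≐⇔lifts-involutions : ∀ {c ℓ} (G : Group c ℓ) (Q L : Subgroup G) → Q ⊆ L →
  (normal : IsNormal (toGroup L) (Q ↾ L)) →
  (Ω₁ (quotient (toGroup L) (Q ↾ L) normal) ≐ Ω₁-cosets (toGroup L) (Q ↾ L) normal)
    ⇔ LiftsInvolutions G Q L
Ω₁≐⇔lifts-involutions G Q L Q⊆L normal = mk⇔ lifts λ l →
  (λ {x} → square⊆cosets l {x}) , (λ {x} → cosets⊆square {x})
  where
  open Group G
  open FreeGroupSolver G using (solve; _⊜_; _⊕_; ⊖_; e)
  module Q = Subgroup Q
  module L = Subgroup L
  L/Q = quotient (toGroup L) (Q ↾ L) normal
  square = Ω₁ L/Q
  cosets = Ω₁-cosets (toGroup L) (Q ↾ L) normal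

  lifts : square ≐ cosets → LiftsInvolutions G Q L
  lifts (square⊆ , _) x x∈L xx∈Q with (g , _) , gg≈ε , xg⁻¹∈Q ←
    square⊆ {x , x∈L} (Q.resp (solve 1 (λ x → x ⊕ x ⊜ x ⊕ x ⊕ ⊖ e) refl x) xx∈Q) =
    g , gg≈ε , Q.resp (solve 2 (λ g x → ⊖ (x ⊕ ⊖ g) ⊜ g ⊕ ⊖ x) refl g x) (Q.⁻¹∈ xg⁻¹∈Q)

  square⊆cosets : LiftsInvolutions G Q L → ∀ {x} → square x → cosets x
  square⊆cosets lifts {x , x∈L} xxε⁻¹∈Q with g , gg≈ε , gx⁻¹∈Q ←
    lifts x x∈L (Q.resp (solve 1 (λ x → x ⊕ x ⊕ ⊖ e ⊜ x ⊕ x) refl x) xxε⁻¹∈Q) =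
    (g , L.resp (solve 2 (λ g x → g ⊕ ⊖ x ⊕ x ⊜ g) refl g x) (L.∙∈ (Q⊆L gx⁻¹∈Q) x∈L)) , gg≈ε ,
    Q.resp (solve 2 (λ g x → ⊖ (g ⊕ ⊖ x) ⊜ x ⊕ ⊖ g) refl g x) (Q.⁻¹∈ gx⁻¹∈Q)

  cosets⊆square : ∀ {x} → cosets x → square x
  cosets⊆square {x} (g , gg≈ε , x∼g) = Group.trans L/Q {x · x} {g · g} {Group.ε L/Q}
    (Group.∙-cong L/Q {x} {g} {x} {g} x∼g x∼g)
    (Q.resp (sym (trans (∙-congʳ gg≈ε) (inverseʳ ε))) Q.ε∈)
    where _·_ = Group._∙_ L/Q

-- The four statements, compared through lifting of involutions

theorem1p1 : ∀ {c ℓ} (G : Group c ℓ) → Finite G →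
    (H H₂ N₂ P : Subgroup G) →
    IsSylowOf 2 H H₂ →
    (N₂-sylow : IsSylowOf 2 (normalizer H₂) N₂) →
    IsSylow 2 G P →
    N₂ ⊆ P →
    let
    N = normalizer H₂
    N₂-normal = normal-in-normalizer H₂ N₂ (proj₁ N₂-sylow)
    N-normal = normal-in-normalizer H₂ N (λ g∈N → g∈N)
    [1] = IsPerfectCodeOf (toGroup P) (H₂ ↾ P)
    [2] = Ω₁ (quotient (toGroup N₂) (H₂ ↾ N₂) N₂-normal) ≐ Ω₁-cosets (toGroup N₂) (H₂ ↾ N₂) N₂-normal
    [3] = Ω₁ (quotient (toGroup N) (H₂ ↾ N) N-normal) ≐ Ω₁-cosets (toGroup N) (H₂ ↾ N) N-normal
    [4] = IsPerfectCodeOf G H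
    in ([1] ⇔ [2]) × ([2] ⇔ [3]) × ([3] ⇔ [4])
theorem1p1 G (n , order) H H₂ N₂ P (H₂⊆H , H₂-sylow) (N₂⊆N , N₂-sylow) P-sylow N₂⊆P =
  -- Every statement is first turned into a lifting property, for `P`, `N₂` or `N`. The way back to
  -- `P` leads from `N₂` up to `N` and then down.
  mk⇔ (from [2] ∘ restrict ∘ to [1]) (from [1] ∘ to-P ∘ extend ∘ to [2]) ,
  mk⇔ (from [3] ∘ extend ∘ to [2]) (from [2] ∘ (λ lifts x x∈N₂ → lifts x (N₂⊆N x∈N₂)) ∘ to [3]) ,
  mk⇔ (from [4] ∘ to [3]) (from [3] ∘ to [4])
  where
  open Group G
  open FreeGroupSolver G using (solve; _⊜_; _⊕_; ⊖_; e)
  open CosetCounting G order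
  open Equivalence using (to; from)

  N = normalizer H₂
  module H₂ = Subgroup H₂
  module N = Subgroup N
  module N₂ = Subgroup N₂
  module P = Subgroup P
  module H₂-sylow = IsSylow H₂-sylow
  module N₂-sylow = IsSylow N₂-sylow
  module P-sylow = IsSylow P-sylow

  order-H₂ : HasOrder (toGroup H₂) (2 ^ H₂-sylow.exponent)
  order-H₂ = order-↾⁻ H₂ H H₂⊆H H₂-sylow.order-subgroup

  order-N₂ : HasOrder (toGroup N₂) (2 ^ N₂-sylow.exponent)
  order-N₂ = order-↾⁻ N₂ N N₂⊆N N₂-sylow.order-subgroup

  module H-order = SubgroupOrder G order H H₂-sylow.order-group
  module N-order = SubgroupOrder G order N N₂-sylow.order-group
  module H₂-order = SubgroupOrder G order H₂ order-H₂
  module N₂-order = SubgroupOrder G order N₂ order-N₂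

  H? = H-order.member?
  N? = N-order.member?
  H₂? = H₂-order.member?
  N₂? = N₂-order.member?

  #H₂∣ : # H₂? ∣ 2 ^ H₂-sylow.exponent
  #H₂∣ = ∣-reflexive H₂-order.#-member

  N₂-odd-index : ¬ 2 * # N₂? ∣ # N?
  N₂-odd-index = 2-part⇒odd-index {N₂-sylow.exponent} N₂-order.#-member N-order.#-member N₂-sylow.coprime

  open TwoSubgroup G order H₂ H₂? {H₂-sylow.exponent} #H₂∣

  -- Since `N` normalizes `H₂`, a single g in `N` with g⁻¹H₂g inside `N₂` would force the inclusion.
  -- With no such g, the double cosets `H₂gN₂` in `N` would all have even index over `N₂`, against
  -- its odd index in `N`.
  H₂⊆N₂ : H₂ ⊆ N₂
  H₂⊆N₂ {x} x∈H₂ = decidable-stable (N₂? x) λ x∉N₂ → N₂-odd-index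
    (DoubleCosets.∣#-without-conjugates H₂ N₂ H₂? N₂? {H₂-sylow.exponent} #H₂∣ N? N.resp
      (λ r∈H₂ → N.∙∈ (subgroup⊆normalizer r∈H₂))
      (λ k∈N₂ y∈N → N.∙∈ y∈N (N₂⊆N k∈N₂))
      (λ {g} g∈N conj → x∉N₂ (N₂.resp (solve 2 (λ g x → ⊖ g ⊕ (g ⊕ x ⊕ ⊖ g) ⊕ g ⊜ x) refl g x)
        (conj _ (to (g∈N x) x∈H₂)))))

  restrict : LiftsInvolutions (toGroup P) (H₂ ↾ P) (normalizer (H₂ ↾ P)) → LiftsInvolutions G H₂ N₂
  restrict lifts x x∈N₂ xx∈H₂ =
    let ((g , _) , gg≈ε , gx⁻¹∈H₂) = lifts (x , N₂⊆P x∈N₂) (λ (z , _) → N₂⊆N x∈N₂ z) xx∈H₂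
    in g , gg≈ε , gx⁻¹∈H₂

  H₂⊆P : H₂ ⊆ P
  H₂⊆P = N₂⊆P ∘ H₂⊆N₂

  to-P : LiftsInvolutions G H₂ N → LiftsInvolutions (toGroup P) (H₂ ↾ P) (normalizer (H₂ ↾ P))
  to-P lifts (x , x∈P) x∈N xx∈H₂ =
    let (g , gg≈ε , gx⁻¹∈H₂) = lifts x x∈NG xx∈H₂
    in (g , P.resp (solve 2 (λ g x → g ⊕ ⊖ x ⊕ x ⊜ g) refl g x) (P.∙∈ (H₂⊆P gx⁻¹∈H₂) x∈P)) ,
       gg≈ε , gx⁻¹∈H₂
    where
    -- Conjugation by an element of `P` maps nothing from outside `P` into `H₂`, so normalizing
    -- inside `P` is normalizing in `G`.
    x∈NG : member N x
    x∈NG z = mk⇔ (λ z∈H₂ → to (x∈N (z , H₂⊆P z∈H₂)) z∈H₂)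
      (λ xzx⁻¹∈H₂ → from (x∈N (z , P.resp (solve 2 (λ x z → ⊖ x ⊕ (x ⊕ z ⊕ ⊖ x) ⊕ x ⊜ z) refl x z)
        (P.∙∈ (P.∙∈ (P.⁻¹∈ x∈P) (H₂⊆P xzx⁻¹∈H₂)) x∈P))) xzx⁻¹∈H₂)

  -- Right multiplication by x permutes the right cosets of N₂ in N; the square
  -- of this permutation is trivial, so it fixes one of the oddly many cosets.
  conjugate-in-N₂ : ∀ {x} → member N x → member H₂ (x ∙ x) →
                    ∃ λ y → member N y × member N₂ (y ∙ x ∙ y ⁻¹)
  conjugate-in-N₂ {x} x∈N xx∈H₂ = decidable-stable
    (any? (λ y≈z (y∈N , c) → N.resp y≈z y∈N , N₂.resp (∙-cong (∙-congʳ y≈z) (⁻¹-cong y≈z)) c)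
          (λ y → N? y ×-dec N₂? (y ∙ x ∙ y ⁻¹)))
    λ none → N₂-odd-index (∣#-free-involution N₂ N₂? N? N.resp
      (λ y∼z y∈N → Mod.∼⇒∈ N (N₂⊆N y∼z) y∈N)
      (_∙ x) (λ y∈N → N.∙∈ y∈N x∈N)
      (λ _ → Mod.∼-∙ʳ N₂ x)
      (λ {y} y∈N → N₂.resp (solve 2 (λ x y → ⊖ (y ⊕ (x ⊕ x) ⊕ ⊖ y) ⊜ y ⊕ ⊖ (y ⊕ x ⊕ x)) refl x y)
        (N₂.⁻¹∈ (H₂⊆N₂ (to (y∈N _) xx∈H₂))))
      (λ {y} y∈N fixed → none (y , y∈N ,
        N₂.resp (solve 2 (λ x y → ⊖ (y ⊕ ⊖ (y ⊕ x)) ⊜ y ⊕ x ⊕ ⊖ y) refl x y) (N₂.⁻¹∈ fixed))))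

  -- Lift the conjugate in `N₂` and conjugate back by `y`, which preserves congruence modulo `H₂`
  -- because `y` normalizes it.
  extend : LiftsInvolutions G H₂ N₂ → LiftsInvolutions G H₂ N
  extend lifts x x∈N xx∈H₂ with y , y∈N , x′∈N₂ ← conjugate-in-N₂ x∈N xx∈H₂
    with g , gg≈ε , gx′⁻¹∈H₂ ← lifts _ x′∈N₂
      (H₂.resp (solve 2 (λ x y → y ⊕ (x ⊕ x) ⊕ ⊖ y ⊜ y ⊕ x ⊕ ⊖ y ⊕ (y ⊕ x ⊕ ⊖ y)) refl x y)
        (to (y∈N _) xx∈H₂)) =
    y ⁻¹ ∙ g ∙ y ,
    trans (solve 2 (λ g y → ⊖ y ⊕ g ⊕ y ⊕ (⊖ y ⊕ g ⊕ y) ⊜ ⊖ y ⊕ (g ⊕ g) ⊕ y) refl g y)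
      (trans (∙-congʳ (∙-congˡ gg≈ε)) (solve 1 (λ y → ⊖ y ⊕ e ⊕ y ⊜ e) refl y)) ,
    H₂.resp (solve 3 (λ g x y → ⊖ y ⊕ (g ⊕ ⊖ (y ⊕ x ⊕ ⊖ y)) ⊕ y ⊜ ⊖ y ⊕ g ⊕ y ⊕ ⊖ x) refl g x y)
      (normalizes⇒conjugates y∈N _ gx′⁻¹∈H₂)

  [2] = Ω₁≐⇔lifts-involutions G H₂ N₂ H₂⊆N₂ (normal-in-normalizer H₂ N₂ N₂⊆N)
  [3] = Ω₁≐⇔lifts-involutions G H₂ N subgroup⊆normalizer (normal-in-normalizer H₂ N id)
  [4] = OddIndex.perfect-code⇔lifts-involutions G order H₂ H H₂? H? H₂⊆H
    (2-part⇒odd-index {H₂-sylow.exponent} H₂-order.#-member H-order.#-member H₂-sylow.coprime)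
    {H₂-sylow.exponent} #H₂∣

  module H₂↾P-order = SubgroupOrder (toGroup P) P-sylow.order-subgroup
    (H₂ ↾ P) (order-↾⁺ H₂ P H₂⊆P order-H₂)
  H₂↾P? = H₂↾P-order.member?
  #H₂↾P = H₂↾P-order.#-member

  -- In `P` the 2-subgroup and the code are the same group, so the odd index is 1.
  [1] = OddIndex.perfect-code⇔lifts-involutions (toGroup P) P-sylow.order-subgroup
    (H₂ ↾ P) (H₂ ↾ P) H₂↾P? H₂↾P? id
    (2-part⇒odd-index {H₂-sylow.exponent} {1} #H₂↾P (≡.trans #H₂↾P (≡.sym (ℕ.*-identityʳ _)))
      λ 2∣1 → contradiction (∣1⇒≡1 2∣1) λ ())
    {H₂-sylow.exponent} (∣-reflexive #H₂↾P)
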